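{- Let $q$ be a prime power, let $n,k$ be positive integers and $\gamma\in\mathbb{F}_{q^n}^*$. Then the polynomial $X+\gamma\,\mathrm{Tr}_{q^n/q}(X^k)$ is a permutation polynomial over $\mathbb{F}_{q^n}$ in each of the following cases: (a) $n=2$, $q\equiv \pm 1\pmod 6$, $\gamma=-1/3$, $k=2q-1$; (b) $n=2$, $q\equiv 5\pmod 6$, $\gamma^3=-1/27$, $k=2q-1$; (c) $n=2$, $q\equiv 1\pmod 3$, $\gamma=1$, $k=(q^2+q+1)/3$; (d) $n=2$, $q\equiv 1\pmod 4$, $(2\gamma)^{(q+1)/2}=1$, $k=(q+1)^2/4$; (e) $n=2$, $q=Q^2$ with $Q>0$ odd, $\gamma=-1$, $k=Q^3-Q+1$; (f) $n=2$, $q=Q^2$ with $Q>0$ odd, $\gamma=-1$, $k=Q^3+Q^2-Q$; (g) $n=3$, $q$ odd, $\gamma=1$, $k=(q^2+1)/2$; (h) $n=3$, $q$ odd, $\gamma=-1/2$, $k=q^2-q+1$; (i) $n=2\ell r$, $\gamma^{q^{2\ell}-1}=-1$, $k=q^\ell+1$, for some positive integers $\ell$ and $r$.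
   Context: $\mathbb{F}_q$ denotes the finite field with $q$ elements. $\mathrm{Tr}_{q^n/q}(X)$ denotes the polynomial $X^{q^{n-1}}+X^{q^{n-2}}+\dots+X^q+X$. A permutation polynomial over $\mathbb{F}_{q^n}$ is a polynomial in $\mathbb{F}_{q^n}[X]$ whose induced map $\mathbb{F}_{q^n}\to\mathbb{F}_{q^n}$ is a bijection. In (e),(f), $Q$ is a prime power. -}

module Defs where

open import Level using (0ℓ)
open import Algebra.Bundles using (CommutativeRing)
open import Data.Nat using (ℕ; zero; suc; _≤_; _%_; _/_)
open import Data.Nat as N using ()
open import Data.Nat.Primality using (Prime)
open import Data.Fin using (Fin)
open import Data.Product using (∃; ∃₂; _×_)
open import Data.Sum using (_⊎_)
open import Function.Bundles using (_↔_)
open import Function.Definitions using (Bijective)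
open import Relation.Nullary using (¬_)
open import Relation.Binary.PropositionalEquality using (_≡_)

IsPrimePower : ℕ → Set
IsPrimePower q = ∃₂ λ p m → Prime p × 1 ≤ m × q ≡ N._^_ p m

-- A finite field with exactly `size` elements (a model of F_{size}).
-- The ring equality is required to coincide with propositional equality,
-- so that the cardinality (bijection with Fin size) and bijectivity are
-- the honest set-theoretic notions.
record FiniteField (size : ℕ) : Set₁ where
  field
    commRing : CommutativeRing 0ℓ 0ℓ
  open CommutativeRing commRing public
  field
    ≈⇒≡     : ∀ {x y} → x ≈ y → x ≡ y
    1≉0     : ¬ (1# ≈ 0#)
    inverse : ∀ x → ¬ (x ≈ 0#) → ∃ λ y → x * y ≈ 1#
    card    : Carrier ↔ Fin size

module _ {size : ℕ} (F : FiniteField size) where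
  open FiniteField F

  pow : Carrier → ℕ → Carrier
  pow x zero    = 1#
  pow x (suc m) = x * pow x m

  #_ : ℕ → Carrier
  # zero  = 0#
  # suc m = 1# + # m

  Tr : (q n : ℕ) → Carrier → Carrier
  Tr q zero    x = 0#
  Tr q (suc i) x = pow x (N._^_ q i) + Tr q i x

  IsPermutation : (Carrier → Carrier) → Set
  IsPermutation f = Bijective _≡_ _≡_ f

  data Case (q n k : ℕ) (γ : Carrier) : Set where
    case-a : n ≡ 2 → (q % 6 ≡ 1 ⊎ q % 6 ≡ 5) → (# 3) * γ ≈ - 1#
           → k ≡ N._∸_ (N._*_ 2 q) 1 → Case q n k γ
    case-b : n ≡ 2 → q % 6 ≡ 5 → (# 27) * pow γ 3 ≈ - 1#
           → k ≡ N._∸_ (N._*_ 2 q) 1 → Case q n k γ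
    case-c : n ≡ 2 → q % 3 ≡ 1 → γ ≈ 1#
           → k ≡ (N._+_ (N._+_ (N._^_ q 2) q) 1) / 3 → Case q n k γ
    case-d : n ≡ 2 → q % 4 ≡ 1 → pow ((# 2) * γ) ((N._+_ q 1) / 2) ≈ 1#
           → k ≡ (N._^_ (N._+_ q 1) 2) / 4 → Case q n k γ
    case-e : (Q : ℕ) → IsPrimePower Q → n ≡ 2 → q ≡ N._^_ Q 2 → Q % 2 ≡ 1
           → γ ≈ - 1# → k ≡ N._+_ (N._∸_ (N._^_ Q 3) Q) 1 → Case q n k γ
    case-f : (Q : ℕ) → IsPrimePower Q → n ≡ 2 → q ≡ N._^_ Q 2 → Q % 2 ≡ 1
           → γ ≈ - 1# → k ≡ N._∸_ (N._+_ (N._^_ Q 3) (N._^_ Q 2)) Q → Case q n k γ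
    case-g : n ≡ 3 → q % 2 ≡ 1 → γ ≈ 1#
           → k ≡ (N._+_ (N._^_ q 2) 1) / 2 → Case q n k γ
    case-h : n ≡ 3 → q % 2 ≡ 1 → (# 2) * γ ≈ - 1#
           → k ≡ N._+_ (N._∸_ (N._^_ q 2) q) 1 → Case q n k γ
    case-i : (ℓ r : ℕ) → 1 ≤ ℓ → 1 ≤ r → n ≡ N._*_ (N._*_ 2 ℓ) r
           → pow γ (N._∸_ (N._^_ q (N._*_ 2 ℓ)) 1) ≈ - 1# → k ≡ N._+_ (N._^_ q ℓ) 1 → Case q n k γ

{-# OPTIONS --safe #-}
module Submission where

-- An injective self-map of a finite set is bijective. If f x = f x′ then x - x′ is γ times an
-- element of F_q, so each case becomes a polynomial identity between the conjugates of x and x′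
-- under the Frobenius maps.
--  * In (a) and (e) a nontrivial coincidence would equate the squares of a fixed and an antifixed
--    element of a Frobenius map; in (h) it makes a product of three conjugate factors vanish, hence
--    each of them. Either way x and x′ lie in F_q, where f is multiplication by 1 + n γ ≢ 0.
--  * (b) is (a) twisted by a cube root of unity, and (f) is (e) for the inverse Frobenius.
--  * In (c) and (g) a value c = f x ≢ 0 and its conjugates determine x; in (c), c ^ q / c = x ^ k / x.
--  * In (d), f fixes the nonsquares and maps the nonzero squares injectively to squares.
--  * In (i), expanding x ^ (q ^ ℓ + 1) at x = x′ + γ t gives two correction terms of trace zero.

open import Defs
open import Level using (0ℓ)
open import Algebra.Bundles using (CommutativeRing)
import Algebra.Properties.CommutativeMonoid.Sum as Sum
import Algebra.Properties.CommutativeSemiring.Binomial as Binomial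
import Algebra.Properties.Ring as RingProperties
import Algebra.Properties.Semiring.Exp as SemiringExp
import Algebra.Properties.Semiring.Mult as SemiringMult
import Algebra.Solver.Ring as RingSolver
open import Algebra.Solver.Ring.AlmostCommutativeRing using (fromCommutativeRing; _-Raw-AlmostCommutative⟶_)
open import Data.Fin as Fin using (Fin; toℕ; punchOut)
open import Data.Fin.Patterns using (0F; 1F; 2F; 3F; 4F; 5F)
import Data.Fin.Permutation as Perm
import Data.Fin.Properties as FinP
open import Data.Integer as ℤ using (ℤ) renaming (+_ to pos; -[1+_] to negsuc)
import Data.Integer.Properties as ℤP
import Data.Maybe as Maybe
open import Data.Nat as ℕ using (ℕ; zero; suc; _!)
open import Data.Nat.Combinatorics using (_C_; nCn≡1; nCk≡n!/k![n-k]!; k![n∸k]!∣n!)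
open import Data.Nat.Divisibility using (_∣_; divides; ∣⇒≤; m∣m*n)
open import Data.Nat.DivMod using (m/n*n≡m; m*n/n≡m; m≡m%n+[m/n]*n)
open import Data.Nat.Primality using (Prime; euclidsLemma; prime⇒nonTrivial; prime⇒nonZero)
import Data.Nat.Properties as ℕP
open import Data.Nat.Solver using (module +-*-Solver)
open import Data.Product using (_×_; _,_; ∃; proj₁; proj₂)
open import Data.Sum as Sum⊎ using (_⊎_; inj₁; inj₂; [_,_]′)
open import Data.Vec using ([]; _∷_; map)
open import Data.Vec.Properties using (lookup-map)
open import Function using (_∘_; id)
open import Function.Bundles using (module Inverse)
open import Function.Definitions using (Injective)
open import Relation.Binary.PropositionalEquality
open import Relation.Nullary using (¬_; Dec; contradiction; yes; no)
open import Relation.Nullary.Decidable using (decidable-stable; dec⇒maybe; map′)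

-- The exponents make `x ^ k` a rational function of the conjugates of x (in (a) it is (σ x)² / x)
-- or a root of a monomial in them (in (c) and (g)), and division would force a separate treatment
-- of 0. The core lemmas therefore know nothing of k: they take the trace T, or the power y, as an
-- unknown tied to the conjugates by equations without denominators, which hold at 0 as well. They
-- also know nothing of q: σ is any ring endomorphism with the required period, so an inverse
-- Frobenius may replace the Frobenius. Such a lemma cannot give injectivity outright. Its argument
-- cancels a difference of conjugates or a value of f, so it ends in a dichotomy: x = x′, or both
-- are fixed. In every case handled this way k ≡ 1 modulo q - 1, hence `x ^ k` is x itself on the
-- fixed field, which disposes of the second alternative.

module ℕ-Solver = +-*-Solver
open ℕ-Solver using () renaming (con to con′; _:+_ to _:+′_; _:*_ to _:*′_; _:^_ to _:^′_; _:=_ to _:=′_)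

-- Finite sets and binomial coefficients modulo a prime

Fin-injective⇒surjective : ∀ {n} {f : Fin n → Fin n} → Injective _≡_ _≡_ f → ∀ j → ∃ λ i → f i ≡ j
Fin-injective⇒surjective {suc n} {f} f-inj j with FinP.any? (λ i → f i FinP.≟ j)
... | yes hit = hit
-- Punching the missed value out of the codomain would inject `Fin (suc n)` into `Fin n`.
... | no miss = contradiction (FinP.injective⇒≤ avoid-inj) ℕP.1+n≰n
  where
  j≢f : ∀ i → j ≢ f i
  j≢f i eq = miss (i , sym eq)

  avoid-inj : Injective _≡_ _≡_ (λ i → punchOut (j≢f i))
  avoid-inj {i} {i′} eq = f-inj (FinP.punchOut-injective (j≢f i) (j≢f i′) eq)

prime∤! : ∀ {p} → Prime p → ∀ {j} → j ℕ.< p → ¬ (p ∣ j !)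
prime∤! pr {zero} _ p∣1 = ℕP.<⇒≱ (ℕ.nonTrivial⇒n>1 _ {{prime⇒nonTrivial pr}}) (∣⇒≤ p∣1)
prime∤! pr {suc j} j<p p∣ with euclidsLemma (suc j) (j !) pr p∣
... | inj₁ p∣1+j = ℕP.<⇒≱ j<p (∣⇒≤ p∣1+j)
... | inj₂ p∣j!  = prime∤! pr (ℕP.<-trans (ℕP.n<1+n j) j<p) p∣j!

-- p divides p! = C(p,k) · k! (p - k)!, and both factorials are products of numbers below p.
prime∣C : ∀ {p k} → Prime p → 0 ℕ.< k → k ℕ.< p → p ∣ p C k
prime∣C {suc p} {k} pr 0<k k<p with euclidsLemma (suc p C k) (k ! ℕ.* (suc p ℕ.∸ k) !) pr p∣
  where
  k≤p = ℕP.<⇒≤ k<p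
  instance _ = k ℕP.!* (suc p ℕ.∸ k) !≢0

  p∣ : suc p ∣ (suc p C k) ℕ.* (k ! ℕ.* (suc p ℕ.∸ k) !)
  p∣ = subst (suc p ∣_)
    (sym (trans (cong (ℕ._* (k ! ℕ.* (suc p ℕ.∸ k) !)) (nCk≡n!/k![n-k]! k≤p)) (m/n*n≡m (k![n∸k]!∣n! k≤p))))
    (m∣m*n (p !))
... | inj₁ p∣C = p∣C
... | inj₂ p∣!! with euclidsLemma (k !) _ pr p∣!!
...   | inj₁ p∣k! = contradiction p∣k! (prime∤! pr k<p)
...   | inj₂ p∣!  = contradiction p∣! (prime∤! pr (ℕP.∸-monoʳ-< 0<k (ℕP.<⇒≤ k<p)))

primePower-nonZero : ∀ {q} → IsPrimePower q → ℕ.NonZero q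
primePower-nonZero (p , m , pr , _ , refl) = ℕP.m^n≢0 p m {{prime⇒nonZero pr}}

-- Arithmetic of a finite field: solver, Fermat's identity, Frobenius

module Field {size : ℕ} (F : FiniteField size) where
  private module F = FiniteField F
  open F using (Carrier; ≈⇒≡)

  -- `≈⇒≡` upgrades every ring law to propositional equality. Congruence steps can then be `cong`,
  -- and maps of the field need no proof that they respect `≈`.
  R : CommutativeRing 0ℓ 0ℓ
  R = record
    { _≈_ = _≡_ ; _+_ = F._+_ ; _*_ = F._*_ ; -_ = λ x → F.- x ; 0# = F.0# ; 1# = F.1#
    ; isCommutativeRing = record
      { isRing = record
        { +-isAbelianGroup = record
          { isGroup = record
            { isMonoid = record
              { isSemigroup = record
                { isMagma = record { isEquivalence = isEquivalence ; ∙-cong = cong₂ F._+_ }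
                ; assoc = λ x y z → ≈⇒≡ (F.+-assoc x y z) }
              ; identity = (λ x → ≈⇒≡ (F.+-identityˡ x)) , λ x → ≈⇒≡ (F.+-identityʳ x) }
            ; inverse = (λ x → ≈⇒≡ (F.-‿inverseˡ x)) , λ x → ≈⇒≡ (F.-‿inverseʳ x)
            ; ⁻¹-cong = cong (λ x → F.- x) }
          ; comm = λ x y → ≈⇒≡ (F.+-comm x y) }
        ; *-cong = cong₂ F._*_
        ; *-assoc = λ x y z → ≈⇒≡ (F.*-assoc x y z)
        ; *-identity = (λ x → ≈⇒≡ (F.*-identityˡ x)) , λ x → ≈⇒≡ (F.*-identityʳ x)
        ; distrib = (λ x y z → ≈⇒≡ (F.distribˡ x y z)) , λ x y z → ≈⇒≡ (F.distribʳ x y z) }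
      ; *-comm = λ x y → ≈⇒≡ (F.*-comm x y) } }

  open CommutativeRing R public hiding (Carrier; refl; sym; trans; isEquivalence)
  open RingProperties ring public using (-‿involutive; +-cancelˡ; +-cancelʳ)
  open RingProperties ring hiding (-‿involutive; +-cancelˡ; +-cancelʳ)
  open SemiringMult semiring using (×-homo-+; ×1-homo-*; ×-assoc-*) renaming (_×_ to _·_)

  -- Integers serve as solver coefficients, so numerals are normalised independently of the
  -- characteristic; `con (negsuc n)` stands for -(n + 1).
  fromℤ : ℤ → Carrier
  fromℤ (pos n)    = n · 1#
  fromℤ (negsuc n) = - (suc n · 1#)

  open ≡-Reasoning

  fromℤ-neg : ∀ i → fromℤ (ℤ.- i) ≡ - fromℤ i
  fromℤ-neg (pos zero)  = sym -0#≈0#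
  fromℤ-neg (pos (suc n)) = refl
  fromℤ-neg (negsuc n)  = sym (-‿involutive _)

  fromℤ-⊖ : ∀ m n → fromℤ (m ℤ.⊖ n) ≡ m · 1# + - (n · 1#)
  fromℤ-⊖ m zero = sym (trans (cong (m · 1# +_) -0#≈0#) (+-identityʳ _))
  fromℤ-⊖ zero (suc n) = sym (+-identityˡ _)
  fromℤ-⊖ (suc m) (suc n) = begin
    fromℤ (suc m ℤ.⊖ suc n)             ≡⟨ cong fromℤ (ℤP.[1+m]⊖[1+n]≡m⊖n m n) ⟩
    fromℤ (m ℤ.⊖ n)                     ≡⟨ fromℤ-⊖ m n ⟩
    m′ + - n′                           ≡⟨ cong (_+ - n′) (sym (+-identityʳ m′)) ⟩
    m′ + 0# + - n′                      ≡⟨ cong (λ z → m′ + z + - n′) (sym (-‿inverseʳ 1#)) ⟩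
    m′ + (1# + - 1#) + - n′             ≡⟨ cong (_+ - n′) (sym (+-assoc m′ 1# (- 1#))) ⟩
    m′ + 1# + - 1# + - n′               ≡⟨ +-assoc _ _ _ ⟩
    m′ + 1# + (- 1# + - n′)             ≡⟨ cong₂ _+_ (+-comm m′ 1#) (-‿+-comm 1# n′) ⟩
    suc m · 1# + - (suc n · 1#)         ∎
    where
    m′ = m · 1#
    n′ = n · 1#

  fromℤ-+ : ∀ i j → fromℤ (i ℤ.+ j) ≡ fromℤ i + fromℤ j
  fromℤ-+ (pos m)    (pos n)    = ×-homo-+ 1# m n
  fromℤ-+ (pos m)    (negsuc n) = fromℤ-⊖ m (suc n)
  fromℤ-+ (negsuc m) (pos n)    = trans (fromℤ-⊖ n (suc m)) (+-comm _ _)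
  fromℤ-+ (negsuc m) (negsuc n) = begin
    - ((2 ℕ.+ (m ℕ.+ n)) · 1#)           ≡⟨ cong (λ k → - (k · 1#)) (cong suc (ℕP.+-suc m n)) ⟨
    - ((suc m ℕ.+ suc n) · 1#)           ≡⟨ cong -_ (×-homo-+ 1# (suc m) (suc n)) ⟩
    - (suc m · 1# + suc n · 1#)          ≡⟨ -‿+-comm _ _ ⟨
    - (suc m · 1#) + - (suc n · 1#)      ∎

  fromℤ-+* : ∀ m j → fromℤ (pos m ℤ.* j) ≡ fromℤ (pos m) * fromℤ j
  fromℤ-+* m (pos n) = trans (cong fromℤ (sym (ℤP.pos-* m n))) (×1-homo-* m n)
  fromℤ-+* m (negsuc n) = begin
    fromℤ (pos m ℤ.* (negsuc n))          ≡⟨ cong fromℤ (ℤP.neg-distribʳ-* (pos m) (pos (suc n))) ⟨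
    fromℤ (ℤ.- (pos m ℤ.* pos (suc n)))     ≡⟨ fromℤ-neg (pos m ℤ.* pos (suc n)) ⟩
    - fromℤ (pos m ℤ.* pos (suc n))         ≡⟨ cong -_ (fromℤ-+* m (pos (suc n))) ⟩
    - (m · 1# * (suc n · 1#))         ≡⟨ -‿distribʳ-* _ _ ⟩
    m · 1# * - (suc n · 1#)           ∎

  fromℤ-* : ∀ i j → fromℤ (i ℤ.* j) ≡ fromℤ i * fromℤ j
  fromℤ-* (pos m) j = fromℤ-+* m j
  fromℤ-* (negsuc m) j = begin
    fromℤ ((negsuc m) ℤ.* j)            ≡⟨ cong fromℤ (ℤP.neg-distribˡ-* (pos (suc m)) j) ⟨
    fromℤ (ℤ.- (pos (suc m) ℤ.* j))       ≡⟨ fromℤ-neg (pos (suc m) ℤ.* j) ⟩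
    - fromℤ (pos (suc m) ℤ.* j)           ≡⟨ cong -_ (fromℤ-+* (suc m) j) ⟩
    - (suc m · 1# * fromℤ j)          ≡⟨ -‿distribˡ-* _ _ ⟩
    - (suc m · 1#) * fromℤ j          ∎

  ℤ-morphism : ℤ.+-*-rawRing -Raw-AlmostCommutative⟶ fromCommutativeRing R
  ℤ-morphism = record
    { ⟦_⟧ = fromℤ ; +-homo = fromℤ-+ ; *-homo = fromℤ-* ; -‿homo = fromℤ-neg
    ; 0-homo = refl ; 1-homo = +-identityʳ 1# }

  open RingSolver ℤ.+-*-rawRing (fromCommutativeRing R) ℤ-morphism
    (λ i j → Maybe.map (cong fromℤ) (dec⇒maybe (i ℤ.≟ j))) public
    using (Polynomial; var; op; [+]; [*]; ⟦_⟧; solve; _:+_; _:*_; _:-_; :-_; _:^_; _:=_; con)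

  -- κ k evaluates to 1# + (… + (1# + 0#)); in particular κ 1 is not definitionally 1#.
  κ : ∀ {n} → ℕ → Polynomial n
  κ k = con (pos k)

  private
    open module Card = Inverse F.card using (to; from; strictlyInverseˡ; strictlyInverseʳ)

    to-injective : Injective _≡_ _≡_ to
    to-injective {x} {y} eq = trans (sym (strictlyInverseʳ x)) (trans (cong from eq) (strictlyInverseʳ y))

  infix 4 _≟_
  _≟_ : (x y : Carrier) → Dec (x ≡ y)
  x ≟ y = map′ to-injective (cong to) (to x FinP.≟ to y)

  injective⇒permutation : ∀ {f} → Injective _≡_ _≡_ f → IsPermutation F f
  injective⇒permutation {f} f-inj = f-inj , λ y → preimage y , λ where refl → image y
    where
    g : Fin size → Fin size
    g i = to (f (from i))

    g-inj : Injective _≡_ _≡_ g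
    g-inj {i} {j} eq = trans (sym (strictlyInverseˡ i))
      (trans (cong to (f-inj (to-injective eq))) (strictlyInverseˡ j))

    preimage : Carrier → Carrier
    preimage y = from (proj₁ (Fin-injective⇒surjective g-inj (to y)))

    image : ∀ y → f (preimage y) ≡ y
    image y = to-injective (proj₂ (Fin-injective⇒surjective g-inj (to y)))

  1≢0 : 1# ≢ 0#
  1≢0 eq = F.1≉0 (F.reflexive eq)

  invertible : ∀ {x} → x ≢ 0# → ∃ λ y → y * x ≡ 1#
  invertible {x} x≢0 with F.inverse x (x≢0 ∘ ≈⇒≡)
  ... | y , xy≈1 = y , trans (*-comm y x) (≈⇒≡ xy≈1)

  *-cancelˡ : ∀ {x y z} → x ≢ 0# → x * y ≡ x * z → y ≡ z
  *-cancelˡ {x} {y} {z} x≢0 eq with invertible x≢0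
  ... | w , wx≡1 = begin
    y           ≡⟨ *-identityˡ y ⟨
    1# * y      ≡⟨ cong (_* y) wx≡1 ⟨
    w * x * y   ≡⟨ *-assoc w x y ⟩
    w * (x * y) ≡⟨ cong (w *_) eq ⟩
    w * (x * z) ≡⟨ *-assoc w x z ⟨
    w * x * z   ≡⟨ cong (_* z) wx≡1 ⟩
    1# * z      ≡⟨ *-identityˡ z ⟩
    z           ∎

  zero-product : ∀ {x y} → x * y ≡ 0# → x ≡ 0# ⊎ y ≡ 0#
  zero-product {x} {y} eq with x ≟ 0#
  ... | yes x≡0 = inj₁ x≡0
  ... | no x≢0  = inj₂ (*-cancelˡ x≢0 (trans eq (sym (zeroʳ x))))

  *-nonzero : ∀ {x y} → x ≢ 0# → y ≢ 0# → x * y ≢ 0#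
  *-nonzero x≢0 y≢0 eq = [ x≢0 , y≢0 ]′ (zero-product eq)

  infixr 8 _^_
  _^_ : Carrier → ℕ → Carrier
  _^_ = pow F

  ^-+ : ∀ x i j → x ^ (i ℕ.+ j) ≡ x ^ i * x ^ j
  ^-+ x zero    j = sym (*-identityˡ _)
  ^-+ x (suc i) j = trans (cong (x *_) (^-+ x i j)) (sym (*-assoc _ _ _))

  1^ : ∀ i → 1# ^ i ≡ 1#
  1^ zero    = refl
  1^ (suc i) = trans (*-identityˡ _) (1^ i)

  *-^ : ∀ x y i → (x * y) ^ i ≡ x ^ i * y ^ i
  *-^ x y zero    = sym (*-identityˡ 1#)
  *-^ x y (suc i) = trans (cong (x * y *_) (*-^ x y i))
    (solve 4 (λ x y a b → x :* y :* (a :* b) := x :* a :* (y :* b)) refl x y (x ^ i) (y ^ i))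

  ^-* : ∀ x i j → x ^ (i ℕ.* j) ≡ (x ^ i) ^ j
  ^-* x zero    j = sym (1^ j)
  ^-* x (suc i) j = trans (^-+ x j (i ℕ.* j))
    (trans (cong (x ^ j *_) (^-* x i j)) (sym (*-^ x (x ^ i) j)))

  ^≡0⇒≡0 : ∀ {x} i → x ^ i ≡ 0# → x ≡ 0#
  ^≡0⇒≡0 zero    eq = contradiction eq 1≢0
  ^≡0⇒≡0 (suc i) eq = [ id , ^≡0⇒≡0 i ]′ (zero-product eq)

  private
    module Exp = SemiringExp semiring
    module +Sum = Sum +-commutativeMonoid
    module *Sum = Sum *-commutativeMonoid

    -- Sums and products over the field are indexed by `Fin size`, so bijections of the field are
    -- moved there along `card`.
    conjugate : (g h : Carrier → Carrier) → (∀ x → g (h x) ≡ x) → (∀ x → h (g x) ≡ x)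
              → Perm.Permutation size size
    conjugate g h gh hg = Perm.permutation (λ i → to (g (from i))) (λ i → to (h (from i)))
      (λ i → trans (cong (λ x → to (g x)) (strictlyInverseʳ _)) (trans (cong to (gh _)) (strictlyInverseˡ i)))
      (λ i → trans (cong (λ x → to (h x)) (strictlyInverseʳ _)) (trans (cong to (hg _)) (strictlyInverseˡ i)))

  ^-zero : ∀ {i} → 0 ℕ.< i → 0# ^ i ≡ 0#
  ^-zero {suc i} _ = zeroˡ _

  -- Translation by 1 permutes the field, so it does not change the sum of all elements.
  size≡0 : size · 1# ≡ 0#
  size≡0 = +-cancelˡ Σx _ _ (begin
    Σx + size · 1#                        ≡⟨ +-comm _ _ ⟩
    size · 1# + Σx                        ≡⟨ cong (_+ Σx) (+Sum.sum-replicate size) ⟨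
    +Sum.sum {size} (λ _ → 1#) + Σx       ≡⟨ +Sum.∑-distrib-+ (λ _ → 1#) from ⟨
    +Sum.sum (λ i → 1# + from i)          ≡⟨ +Sum.sum-cong-≗ (λ i → strictlyInverseʳ (1# + from i)) ⟨
    +Sum.sum (λ i → from (shift Perm.⟨$⟩ʳ i)) ≡⟨ +Sum.sum-permute from shift ⟨
    Σx                                    ≡⟨ +-identityʳ Σx ⟨
    Σx + 0#                               ∎)
    where
    Σx = +Sum.sum from
    shift = conjugate (λ x → 1# + x) (λ x → - 1# + x)
      (λ x → solve 2 (λ o x → o :+ (:- o :+ x) := x) refl 1# x)
      (λ x → solve 2 (λ o x → :- o :+ (o :+ x) := x) refl 1# x)

  private
    product-single : ∀ {n} (i : Fin n) (t : Fin n → Carrier) → (∀ j → j ≢ i → t j ≡ 1#)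
                   → *Sum.sum t ≡ t i
    product-single {suc n} Fin.zero t ones = trans (cong (t Fin.zero *_)
      (trans (*Sum.sum-cong-≗ (λ j → ones (Fin.suc j) λ ())) (*Sum.sum-replicate-zero n))) (*-identityʳ _)
    product-single (Fin.suc i) t ones = trans
      (cong₂ _*_ (ones Fin.zero λ ()) (product-single i (t ∘ Fin.suc) (λ j j≢i → ones (Fin.suc j) (j≢i ∘ FinP.suc-injective))))
      (*-identityˡ _)

    product-nonzero : ∀ {n} (t : Fin n → Carrier) → (∀ j → t j ≢ 0#) → *Sum.sum t ≢ 0#
    product-nonzero {zero}  t t≢0 = 1≢0
    product-nonzero {suc n} t t≢0 = *-nonzero (t≢0 Fin.zero) (product-nonzero (t ∘ Fin.suc) (t≢0 ∘ Fin.suc))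

    product-const : ∀ n x → *Sum.sum {n} (λ _ → x) ≡ x ^ n
    product-const zero    x = refl
    product-const (suc n) x = cong (x *_) (product-const n x)

    if-zero : Carrier → Carrier → Carrier → Carrier
    if-zero a b y with y ≟ 0#
    ... | yes _ = a
    ... | no _  = b

  -- Multiplication by x permutes the field; compare the products of the nonzero elements,
  -- each written as a product over the whole field with 1 in the place of 0.
  fermat : ∀ x → x ^ size ≡ x
  fermat x with x ≟ 0#
  ... | yes refl = ^-zero {size} (ℕP.n≢0⇒n>0 λ { refl → FinP.¬Fin0 (to 0#) })
  ... | no x≢0 with invertible x≢0
  ...   | w , wx≡1 = begin
    x ^ size                                        ≡⟨ product-const size x ⟨
    *Sum.sum {size} (λ _ → x)                       ≡⟨ *Sum.sum-cong-≗ (λ i → units*at0 (from i)) ⟨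
    *Sum.sum (λ i → units (from i) * at0 (from i))  ≡⟨ *Sum.∑-distrib-+ (units ∘ from) (at0 ∘ from) ⟩
    *Sum.sum (units ∘ from) * *Sum.sum (at0 ∘ from) ≡⟨ cong₂ _*_ Πunits≡1 Πat0≡x ⟩
    1# * x                                          ≡⟨ *-identityˡ x ⟩
    x                                               ∎
    where
    -- `nz` is the identity with 1 in the place of 0. `units` and `at0` split the constant x into
    -- its part off 0 and its part at 0, so that x ^ size falls into a product equal to 1 and the
    -- single factor x.
    nz = λ y → if-zero 1# y y
    units = if-zero 1# x
    at0 = if-zero x 1#

    units*at0 : ∀ y → units y * at0 y ≡ x
    units*at0 y with y ≟ 0#
    ... | yes _ = *-identityˡ x
    ... | no _  = *-identityʳ x

    nz-* : ∀ y → nz (x * y) ≡ nz y * units y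
    nz-* y with y ≟ 0# | x * y ≟ 0#
    ... | yes _    | yes _    = sym (*-identityˡ 1#)
    ... | yes refl | no xy≢0  = contradiction (zeroʳ x) xy≢0
    ... | no y≢0   | yes xy≡0 = contradiction xy≡0 (*-nonzero x≢0 y≢0)
    ... | no _     | no _     = *-comm x y

    nz≢0 : ∀ y → nz y ≢ 0#
    nz≢0 y with y ≟ 0#
    ... | yes _  = 1≢0
    ... | no y≢0 = y≢0

    scale = conjugate (x *_) (w *_)
      (λ y → trans (solve 3 (λ x w y → x :* (w :* y) := w :* x :* y) refl x w y) (trans (cong (_* y) wx≡1) (*-identityˡ y)))
      (λ y → trans (sym (*-assoc w x y)) (trans (cong (_* y) wx≡1) (*-identityˡ y)))

    Πunits≡1 : *Sum.sum (units ∘ from) ≡ 1#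
    Πunits≡1 = *-cancelˡ (product-nonzero (nz ∘ from) (nz≢0 ∘ from)) (begin
      *Sum.sum (nz ∘ from) * *Sum.sum (units ∘ from)  ≡⟨ *Sum.∑-distrib-+ (nz ∘ from) (units ∘ from) ⟨
      *Sum.sum (λ i → nz (from i) * units (from i))   ≡⟨ *Sum.sum-cong-≗ (λ i → nz-* (from i)) ⟨
      *Sum.sum (λ i → nz (x * from i))                ≡⟨ *Sum.sum-cong-≗ (λ i → cong nz (strictlyInverseʳ (x * from i))) ⟨
      *Sum.sum (λ i → nz (from (scale Perm.⟨$⟩ʳ i)))  ≡⟨ *Sum.sum-permute (nz ∘ from) scale ⟨
      *Sum.sum (nz ∘ from)                            ≡⟨ *-identityʳ _ ⟨
      *Sum.sum (nz ∘ from) * 1#                       ∎)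

    at0-ones : ∀ j → j ≢ to 0# → at0 (from j) ≡ 1#
    at0-ones j j≢ with from j ≟ 0#
    ... | yes eq = contradiction (trans (sym (strictlyInverseˡ j)) (cong (to) eq)) j≢
    ... | no _   = refl

    at0-zero : ∀ y → y ≡ 0# → at0 y ≡ x
    at0-zero y y≡0 with y ≟ 0#
    ... | yes _  = refl
    ... | no y≢0 = contradiction y≡0 y≢0

    Πat0≡x : *Sum.sum (at0 ∘ from) ≡ x
    Πat0≡x = trans (product-single (to 0#) (at0 ∘ from) at0-ones) (at0-zero _ (strictlyInverseʳ 0#))

  num : ℕ → Carrier
  num n = n · 1#

  num-+ : ∀ m n → num (m ℕ.+ n) ≡ num m + num n
  num-+ = ×-homo-+ 1#

  num-* : ∀ m n → num (m ℕ.* n) ≡ num m * num n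
  num-* = ×1-homo-*

  num-^ : ∀ p m → num (p ℕ.^ m) ≡ num p ^ m
  num-^ p zero    = +-identityʳ 1#
  num-^ p (suc m) = trans (×1-homo-* p (p ℕ.^ m)) (cong (num p *_) (num-^ p m))

  -- Stated for an arbitrary map, so that the results below apply alike to the Frobenius maps, their
  -- iterates and their inverses.
  record IsEndo (σ : Carrier → Carrier) : Set where
    field
      σ-+ : ∀ x y → σ (x + y) ≡ σ x + σ y
      σ-* : ∀ x y → σ (x * y) ≡ σ x * σ y
      σ-1 : σ 1# ≡ 1#

    σ-0 : σ 0# ≡ 0#
    σ-0 = +-cancelˡ (σ 0#) _ _ (trans (sym (σ-+ 0# 0#)) (trans (cong σ (+-identityʳ 0#)) (sym (+-identityʳ (σ 0#)))))

    σ-neg : ∀ x → σ (- x) ≡ - σ x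
    σ-neg x = +-cancelˡ (σ x) _ _ (trans (sym (σ-+ x (- x)))
      (trans (cong σ (-‿inverseʳ x)) (trans σ-0 (sym (-‿inverseʳ (σ x))))))

    σ-num : ∀ n → σ (num n) ≡ num n
    σ-num zero    = σ-0
    σ-num (suc n) = trans (σ-+ 1# (num n)) (cong₂ _+_ σ-1 (σ-num n))

    σ-^ : ∀ x i → σ (x ^ i) ≡ σ x ^ i
    σ-^ x zero    = σ-1
    σ-^ x (suc i) = trans (σ-* x (x ^ i)) (cong (σ x *_) (σ-^ x i))

    σ-nonzero : ∀ {x} → x ≢ 0# → σ x ≢ 0#
    σ-nonzero {x} x≢0 σx≡0 with invertible x≢0
    ... | w , wx≡1 = 1≢0 (begin
      1#         ≡⟨ σ-1 ⟨
      σ 1#       ≡⟨ cong σ wx≡1 ⟨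
      σ (w * x)  ≡⟨ σ-* w x ⟩
      σ w * σ x  ≡⟨ cong (σ w *_) σx≡0 ⟩
      σ w * 0#   ≡⟨ zeroʳ _ ⟩
      0#         ∎)

  open IsEndo

  id-endo : IsEndo id
  id-endo = record { σ-+ = λ _ _ → refl ; σ-* = λ _ _ → refl ; σ-1 = refl }

  ∘-endo : ∀ {σ τ} → IsEndo σ → IsEndo τ → IsEndo (σ ∘ τ)
  ∘-endo {σ} s t = record
    { σ-+ = λ x y → trans (cong σ (σ-+ t x y)) (σ-+ s _ _)
    ; σ-* = λ x y → trans (cong σ (σ-* t x y)) (σ-* s _ _)
    ; σ-1 = trans (cong σ (σ-1 t)) (σ-1 s) }

  endo-cong : ∀ {σ τ} → (∀ x → σ x ≡ τ x) → IsEndo σ → IsEndo τ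
  endo-cong eq s = record
    { σ-+ = λ x y → trans (sym (eq _)) (trans (σ-+ s x y) (cong₂ _+_ (eq x) (eq y)))
    ; σ-* = λ x y → trans (sym (eq _)) (trans (σ-* s x y) (cong₂ _*_ (eq x) (eq y)))
    ; σ-1 = trans (sym (eq 1#)) (σ-1 s) }

  private
    module Bin = Binomial commutativeSemiring

    ^≡exp : ∀ x i → x ^ i ≡ x Exp.^ i
    ^≡exp x zero = refl
    ^≡exp x (suc i) = cong (x *_) (^≡exp x i)

  -- The freshman's dream: p divides the inner binomial coefficients, and multiples of p vanish once
  -- `num p ≡ 0#`.
  prime-endo : ∀ {p} → Prime p → num p ≡ 0# → IsEndo (_^ p)
  prime-endo {suc p} pr p≡0 = record { σ-+ = add ; σ-* = λ x y → *-^ x y (suc p) ; σ-1 = 1^ (suc p) }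
    where
    multiple≡0 : ∀ {n} x → suc p ∣ n → n · x ≡ 0#
    multiple≡0 x (divides k refl) = begin
      (k ℕ.* suc p) · x                ≡⟨ cong ((k ℕ.* suc p) ·_) (*-identityˡ x) ⟨
      (k ℕ.* suc p) · (1# * x)         ≡⟨ ×-assoc-* (k ℕ.* suc p) 1# x ⟨
      num (k ℕ.* suc p) * x            ≡⟨ cong (_* x) (×1-homo-* k (suc p)) ⟩
      num k * num (suc p) * x          ≡⟨ cong (λ z → num k * z * x) p≡0 ⟩
      num k * 0# * x                   ≡⟨ solve 2 (λ k x → k :* κ 0 :* x := κ 0) refl (num k) x ⟩
      0#                               ∎

    add : ∀ x y → (x + y) ^ suc p ≡ x ^ suc p + y ^ suc p
    add x y = begin
      (x + y) ^ suc p                               ≡⟨ ^≡exp (x + y) (suc p) ⟩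
      (x + y) Exp.^ suc p                           ≡⟨ Bin.theorem (suc p) x y ⟩
      t Fin.zero + +Sum.sum (t ∘ Fin.suc)           ≡⟨ cong (t Fin.zero +_) (+Sum.sum-init-last (t ∘ Fin.suc)) ⟩
      t Fin.zero + (+Sum.sum (λ j → t (Fin.suc (Fin.inject₁ j))) + t (Fin.suc (Fin.fromℕ p)))
        ≡⟨ cong₂ _+_ first (cong₂ _+_ (trans (+Sum.sum-cong-≗ middle) (+Sum.sum-replicate-zero p)) final) ⟩
      y ^ suc p + (0# + x ^ suc p)                  ≡⟨ solve 2 (λ a b → b :+ (κ 0 :+ a) := a :+ b) refl (x ^ suc p) (y ^ suc p) ⟩
      x ^ suc p + y ^ suc p                         ∎
      where
      t = Bin.binomialTerm x y (suc p)

      first : t Fin.zero ≡ y ^ suc p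
      first = trans (+-identityʳ _) (trans (*-identityˡ _) (sym (^≡exp y (suc p))))

      middle : ∀ j → t (Fin.suc (Fin.inject₁ j)) ≡ 0#
      middle j = multiple≡0 _ (prime∣C pr (ℕ.s≤s ℕ.z≤n) (ℕ.s≤s (subst (ℕ._< p) (sym (FinP.toℕ-inject₁ j)) (FinP.toℕ<n j))))

      final : t (Fin.suc (Fin.fromℕ p)) ≡ x ^ suc p
      final = begin
        ((suc p C suc k) · (x Exp.^ suc k * y Exp.^ (p ℕ.∸ k)))  ≡⟨ cong (λ k → (suc p C suc k) · (x Exp.^ suc k * y Exp.^ (p ℕ.∸ k))) (FinP.toℕ-fromℕ p) ⟩
        ((suc p C suc p) · (x Exp.^ suc p * y Exp.^ (p ℕ.∸ p)))  ≡⟨ cong₂ (λ c d → c · (x Exp.^ suc p * y Exp.^ d)) (nCn≡1 (suc p)) (ℕP.n∸n≡0 p) ⟩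
        1 · (x Exp.^ suc p * 1#)                               ≡⟨ trans (+-identityʳ _) (*-identityʳ _) ⟩
        x Exp.^ suc p                                          ≡⟨ ^≡exp x (suc p) ⟨
        x ^ suc p                                              ∎
        where k = toℕ (Fin.fromℕ p)

  ^-endo : ∀ {p} → IsEndo (_^ p) → ∀ m → IsEndo (_^ (p ℕ.^ m))
  ^-endo endo zero    = endo-cong (λ x → sym (*-identityʳ x)) id-endo
  ^-endo {p} endo (suc m) = endo-cong (λ x → sym (^-* x p (p ℕ.^ m))) (∘-endo (^-endo {p} endo m) endo)

  -- `num size` is a power of `num p`, it vanishes by `size≡0`, and a field has no nilpotents.
  primePower≡0 : ∀ {p} m j → size ≡ (p ℕ.^ m) ℕ.^ j → num p ≡ 0#
  primePower≡0 {p} m j size≡ = ^≡0⇒≡0 m (trans (sym (num-^ p m)) (^≡0⇒≡0 j (begin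
    num (p ℕ.^ m) ^ j       ≡⟨ num-^ (p ℕ.^ m) j ⟨
    num ((p ℕ.^ m) ℕ.^ j)   ≡⟨ cong num size≡ ⟨
    num size                ≡⟨ size≡0 ⟩
    0#                      ∎)))

  frobenius : ∀ {q} j → IsPrimePower q → size ≡ q ℕ.^ j → IsEndo (_^ q)
  frobenius j (p , m , pr , _ , refl) size≡ = ^-endo {p} (prime-endo pr (primePower≡0 m j size≡)) m

-- Certificates for polynomial identities, and the cubic relation behind (a)

module FieldEquations {size : ℕ} (F : FiniteField size) where
  open Field F
  open FiniteField F using (Carrier)
  open ≡-Reasoning

  -- Ideal-membership certificates; the coefficients c are inferred from the ring identity.
  by₁ : ∀ {x y u v c} → u ≡ v → x ≡ y + c * (u - v) → x ≡ y
  by₁ {y = y} {u} {c = c} refl eq = trans eq (solve 3 (λ y c u → y :+ c :* (u :- u) := y) refl y c u)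

  by₂ : ∀ {x y u v u′ v′ c c′} → u ≡ v → u′ ≡ v′ → x ≡ y + c * (u - v) + c′ * (u′ - v′) → x ≡ y
  by₂ h h′ eq = by₁ h (by₁ h′ eq)

  by₃ : ∀ {x y u v u′ v′ u″ v″ c c′ c″} → u ≡ v → u′ ≡ v′ → u″ ≡ v″
      → x ≡ y + c * (u - v) + c′ * (u′ - v′) + c″ * (u″ - v″) → x ≡ y
  by₃ h h′ h″ eq = by₂ h h′ (by₁ h″ eq)

  difference≡0⇒≡ : ∀ {x y} → x - y ≡ 0# → x ≡ y
  difference≡0⇒≡ {x} {y} h = by₁ h (solve 2 (λ x y → x := y :+ κ 1 :* (x :- y :- κ 0)) refl x y)

  -- An endomorphism fixes the integer coefficients, so it acts on a polynomial expression through
  -- its variables. The separate ρ′ lets their images be simplified first, for instance σ (σ x) to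
  -- x.
  σ-⟦⟧ : ∀ {σ} → IsEndo σ → ∀ {n} (p : Polynomial n) {ρ ρ′} → map σ ρ ≡ ρ′ → σ (⟦ p ⟧ ρ) ≡ ⟦ p ⟧ ρ′
  σ-⟦⟧ {σ} endo p {ρ} refl = push p
    where
    open IsEndo endo

    push : ∀ p → σ (⟦ p ⟧ ρ) ≡ ⟦ p ⟧ (map σ ρ)
    push (op [+] p₁ p₂)   = trans (σ-+ _ _) (cong₂ _+_ (push p₁) (push p₂))
    push (op [*] p₁ p₂)   = trans (σ-* _ _) (cong₂ _*_ (push p₁) (push p₂))
    push (con (pos n))    = σ-num n
    push (con (negsuc n)) = trans (σ-neg _) (cong -_ (σ-num (suc n)))
    push (var x)          = sym (lookup-map x σ ρ)
    push (p :^ zero)      = σ-1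
    push (p :^ suc n)     = trans (σ-* _ _) (cong₂ _*_ (push p) (push (p :^ n)))
    push (:- p)           = trans (σ-neg _) (cong -_ (push p))

  module OddCharacteristic (2≢0 : num 2 ≢ 0#) where

    2*-cancel : ∀ {x} → num 2 * x ≡ 0# → x ≡ 0#
    2*-cancel eq = [ (λ 2≡0 → contradiction 2≡0 2≢0) , id ]′ (zero-product eq)

    ≡-neg⇒≡0 : ∀ {x} → x ≡ - x → x ≡ 0#
    ≡-neg⇒≡0 {x} eq = 2*-cancel (by₁ eq (solve 1 (λ x → κ 2 :* x := κ 0 :+ κ 1 :* (x :- (:- x))) refl x))

    squares-equal : ∀ {x y} → x * x ≡ y * y → x ≡ y ⊎ x ≡ - y
    squares-equal {x} {y} eq with zero-product {x - y} {x + y}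
      (by₁ eq (solve 2 (λ x y → (x :- y) :* (x :+ y) := κ 0 :+ κ 1 :* (x :* x :- y :* y)) refl x y))
    ... | inj₁ h = inj₁ (difference≡0⇒≡ h)
    ... | inj₂ h = inj₂ (by₁ h (solve 2 (λ x y → x := :- y :+ κ 1 :* (x :+ y :- κ 0)) refl x y))

    -- u = ± w, and applying σ to either equation changes the sign on one side only; hence u = - u.
    fixed²≡anti² : ∀ {σ} → IsEndo σ → ∀ {u w} → σ u ≡ u → σ w ≡ - w → u * u ≡ w * w → u ≡ 0# × w ≡ 0#
    fixed²≡anti² {σ} endo {u} {w} σu σw eq = u≡0 , w≡0
      where
      open IsEndo endo

      u≡-u : u ≡ - u
      u≡-u with squares-equal eq
      ... | inj₁ u≡w  = trans (sym σu) (trans (cong σ u≡w) (trans σw (cong -_ (sym u≡w))))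
      ... | inj₂ u≡-w = trans (sym σu) (trans (cong σ u≡-w) (trans (σ-neg w)
                          (cong -_ (trans σw (sym u≡-w)))))

      u≡0 = ≡-neg⇒≡0 u≡-u

      w≡0 : w ≡ 0#
      w≡0 = [ id , id ]′ (zero-product (trans (sym eq) (trans (cong (_* u) u≡0) (zeroˡ u))))

    sum-difference⇒≡ : ∀ {a b a′ b′} → a + b ≡ a′ + b′ → a - b ≡ a′ - b′ → a ≡ a′
    sum-difference⇒≡ {a} {b} {a′} {b′} hs hd = difference≡0⇒≡ (2*-cancel (by₂ hs hd (solve 4 (λ a b a′ b′ →
      κ 2 :* (a :- a′) := κ 0 :+ κ 1 :* (a :+ b :- (a′ :+ b′)) :+ κ 1 :* (a :- b :- (a′ :- b′))) refl a b a′ b′)))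

    module Order2 {σ} (endo : IsEndo σ) (σσ : ∀ x → σ (σ x) ≡ x) where
      open IsEndo endo

      -- With s = x + σ x and d = x - σ x, the quantities d and C = 3 s - 2 T are constant on a fibre and
      -- C (s² - d²) = s³ - 9 s d²; two solutions s ≢ s′ give (s s′ + 3 d²)² = (d (s - s′))².
      cubic-trace : num 3 ≢ 0# → ∀ {x x′ T T′} → σ T ≡ T → σ T′ ≡ T′
        → T * (x * σ x) ≡ x ^ 3 + σ x ^ 3 → T′ * (x′ * σ x′) ≡ x′ ^ 3 + σ x′ ^ 3
        → num 3 * x - T ≡ num 3 * x′ - T′ → x ≡ x′ ⊎ (σ x ≡ x × σ x′ ≡ x′)
      cubic-trace 3≢0 {x} {x′} {T} {T′} σT σT′ hT hT′ eq = conclude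
        where
        b = σ x
        b′ = σ x′
        s = x + b
        s′ = x′ + b′
        d = x - b

        σeq : num 3 * b - T ≡ num 3 * b′ - T′
        σeq = trans (sym (σ-⟦⟧ endo p (cong (λ t → b ∷ t ∷ []) σT)))
          (trans (cong σ eq) (σ-⟦⟧ endo p (cong (λ t → b′ ∷ t ∷ []) σT′)))
          where p = κ 3 :* var 0F :- var 1F

        d≡d′ : d ≡ x′ - b′
        d≡d′ = *-cancelˡ 3≢0 (by₂ eq σeq (solve 6 (λ a b a′ b′ t t′ → κ 3 :* (a :- b) :=
          κ 3 :* (a′ :- b′) :+ κ 1 :* (κ 3 :* a :- t :- (κ 3 :* a′ :- t′))
            :+ con (negsuc 0) :* (κ 3 :* b :- t :- (κ 3 :* b′ :- t′))) refl x b x′ b′ T T′))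

        C≡C′ : num 3 * s - num 2 * T ≡ num 3 * s′ - num 2 * T′
        C≡C′ = by₂ eq σeq (solve 6 (λ a b a′ b′ t t′ → κ 3 :* (a :+ b) :- κ 2 :* t :=
          κ 3 :* (a′ :+ b′) :- κ 2 :* t′ :+ κ 1 :* (κ 3 :* a :- t :- (κ 3 :* a′ :- t′))
            :+ κ 1 :* (κ 3 :* b :- t :- (κ 3 :* b′ :- t′))) refl x b x′ b′ T T′)

        -- For s = a + b and d = a - b one has 4 a b = s² - d² and 4 (a³ + b³) = s³ + 3 s d², so the
        -- hypothesis reads t (s² - d²) = s³ + 3 s d².
        invariant : ∀ {a b t} → t * (a * b) ≡ a ^ 3 + b ^ 3 → (num 3 * (a + b) - num 2 * t) * ((a + b) ^ 2 - (a - b) ^ 2)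
                  ≡ (a + b) ^ 3 - num 9 * (a + b) * (a - b) ^ 2
        invariant {a} {b} {t} h = by₁ h (solve 3 (λ a b t → (κ 3 :* (a :+ b) :- κ 2 :* t) :* ((a :+ b) :^ 2 :- (a :- b) :^ 2) :=
          (a :+ b) :^ 3 :- κ 9 :* (a :+ b) :* (a :- b) :^ 2 :+ con (negsuc 7) :* (t :* (a :* b) :- (a :^ 3 :+ b :^ 3))) refl a b t)

        I : (num 3 * s - num 2 * T) * (s ^ 2 - d ^ 2) ≡ s ^ 3 - num 9 * s * d ^ 2
        I = invariant hT

        I′ : (num 3 * s - num 2 * T) * (s′ ^ 2 - d ^ 2) ≡ s′ ^ 3 - num 9 * s′ * d ^ 2
        I′ = subst₂ (λ c e → c * (s′ ^ 2 - e ^ 2) ≡ s′ ^ 3 - num 9 * s′ * e ^ 2) (sym C≡C′) (sym d≡d′) (invariant hT′)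

        u = s * s′ + num 3 * d ^ 2
        w = d * (s - s′)

        -- Cross-multiplying eliminates the common C and leaves s - s′ times a difference of
        -- squares.
        factored : (s - s′) * (u * u - w * w) ≡ 0#
        factored = by₂ I I′ (solve 4 (λ c s s′ d →
          (s :- s′) :* ((s :* s′ :+ κ 3 :* d :^ 2) :* (s :* s′ :+ κ 3 :* d :^ 2) :- d :* (s :- s′) :* (d :* (s :- s′)))
          := κ 0 :+ (:- (s′ :^ 2 :- d :^ 2)) :* (c :* (s :^ 2 :- d :^ 2) :- (s :^ 3 :- κ 9 :* s :* d :^ 2))
             :+ (s :^ 2 :- d :^ 2) :* (c :* (s′ :^ 2 :- d :^ 2) :- (s′ :^ 3 :- κ 9 :* s′ :* d :^ 2)))
          refl (num 3 * s - num 2 * T) s s′ d)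

        σρ : map σ (x ∷ b ∷ x′ ∷ b′ ∷ []) ≡ b ∷ x ∷ b′ ∷ x′ ∷ []
        σρ = cong₂ (λ y y′ → b ∷ y ∷ b′ ∷ y′ ∷ []) (σσ x) (σσ x′)

        σu : σ u ≡ u
        σu = trans (σ-⟦⟧ endo ((var 0F :+ var 1F) :* (var 2F :+ var 3F) :+ κ 3 :* (var 0F :- var 1F) :^ 2) σρ)
          (solve 4 (λ a b a′ b′ → (b :+ a) :* (b′ :+ a′) :+ κ 3 :* (b :- a) :^ 2 := (a :+ b) :* (a′ :+ b′) :+ κ 3 :* (a :- b) :^ 2) refl x b x′ b′)

        σw : σ w ≡ - w
        σw = trans (σ-⟦⟧ endo ((var 0F :- var 1F) :* (var 0F :+ var 1F :- (var 2F :+ var 3F))) σρ)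
          (solve 4 (λ a b a′ b′ → (b :- a) :* (b :+ a :- (b′ :+ a′)) := :- ((a :- b) :* (a :+ b :- (a′ :+ b′)))) refl x b x′ b′)

        s≡s′⇒ : s - s′ ≡ 0# → x ≡ x′ ⊎ (σ x ≡ x × σ x′ ≡ x′)
        s≡s′⇒ h = inj₁ (sum-difference⇒≡ (difference≡0⇒≡ h) d≡d′)

        d≡0⇒ : d ≡ 0# → x ≡ x′ ⊎ (σ x ≡ x × σ x′ ≡ x′)
        d≡0⇒ h = inj₂ (sym (difference≡0⇒≡ h) , sym (difference≡0⇒≡ (trans (sym d≡d′) h)))

        conclude : x ≡ x′ ⊎ (σ x ≡ x × σ x′ ≡ x′)
        conclude = [ s≡s′⇒ , (λ h → [ d≡0⇒ , s≡s′⇒ ]′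
          (zero-product (proj₂ (fixed²≡anti² endo σu σw (difference≡0⇒≡ h))))) ]′ (zero-product factored)

-- The quartic relation behind (e) and (f)

module QuarticTrace {size : ℕ} (F : FiniteField size) where
  open Field F
  open FieldEquations F
  open FiniteField F using (Carrier)
  open ≡-Reasoning

  module _ (2≢0 : num 2 ≢ 0#) {σ} (endo : IsEndo σ) (σ⁴ : ∀ x → σ (σ (σ (σ x))) ≡ x) where
    open OddCharacteristic 2≢0
    open IsEndo endo

    -- r = w / e satisfies r² = z and σ² r = - r; but σ r = ± r gives σ² r = r.
    square-of-anti : ∀ {w z d e} → σ z ≡ z → σ (σ w) ≡ w → σ d ≡ e → σ e ≡ - d → d ≢ 0#
                   → w * w ≡ e * e * z → w ≡ 0#
    square-of-anti {w} {z} {d} {e} σz σσw σd σe d≢0 h =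
      [ (λ d≡0 → contradiction d≡0 d≢0) , id ]′ (zero-product B≡0)
      where
      -- σ r = - σ w / d and r = w / e, so σ r = ± r becomes A = ± B after clearing denominators.
      A = σ w * e
      B = d * w

      σA : σ A ≡ - B
      σA = trans (σ-* _ _) (trans (cong₂ _*_ σσw σe) (solve 2 (λ w d → w :* (:- d) := :- (d :* w)) refl w d))

      σB : σ B ≡ A
      σB = trans (σ-* _ _) (trans (cong (_* σ w) σd) (*-comm e (σ w)))

      σh : σ w * σ w ≡ d * d * z
      σh = trans (sym (σ-* w w)) (trans (cong σ h)
        (trans (σ-⟦⟧ endo (var 0F :* var 0F :* var 1F) (cong₂ (λ a b → a ∷ b ∷ []) σe σz))
          (solve 2 (λ d z → (:- d) :* (:- d) :* z := d :* d :* z) refl d z)))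

      A²≡B² : A * A ≡ B * B
      A²≡B² = by₂ h σh (solve 5 (λ w w₁ z d e → w₁ :* e :* (w₁ :* e) := d :* w :* (d :* w)
        :+ (:- (d :* d)) :* (w :* w :- e :* e :* z) :+ (e :* e) :* (w₁ :* w₁ :- d :* d :* z)) refl w (σ w) z d e)

      B≡-B : B ≡ - B
      B≡-B = [ (λ A≡B → trans (sym A≡B) (trans (sym σB) (trans (cong σ (sym A≡B)) σA)))
             , (λ A≡-B → let A≡B = trans (sym σB) (trans (cong σ (trans (sym (-‿involutive B)) (cong -_ (sym A≡-B))))
                                      (trans (σ-neg A) (trans (cong -_ σA) (-‿involutive B))))
                         in trans (sym A≡B) A≡-B) ]′ (squares-equal A²≡B²)

      B≡0 : B ≡ 0#
      B≡0 = ≡-neg⇒≡0 B≡-B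

    -- The equation for (s , t) reads c = (4det - st² - 3se²) / (t² - e²); cross-multiplying two solutions and
    -- completing the square gives w² = e² z with a σ-invariant z.
    module _ {c s s′ t t′ d e : Carrier} (σs : σ s ≡ t) (σt : σ t ≡ s) (σs′ : σ s′ ≡ t′) (σt′ : σ t′ ≡ s′)
             (σd : σ d ≡ e) (σe : σ e ≡ - d)
             (h  : c * (t * t - e * e) ≡ num 4 * d * e * t - s * (t * t) - num 3 * s * (e * e))
             (h′ : c * (t′ * t′ - e * e) ≡ num 4 * d * e * t′ - s′ * (t′ * t′) - num 3 * s′ * (e * e)) where
      private
        w = (s - s′) * (t * t′ + e * e) + num 2 * (t - t′) * d * e
        w₁ = (t - t′) * (s * s′ + d * d) - num 2 * (s - s′) * e * d
        z = num 4 * ((t - t′) * (t - t′) * (d * d) + (s - s′) * (s - s′) * (e * e))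
            - (s - s′) * (s - s′) * ((t - t′) * (t - t′)) + num 2 * (s * s - s′ * s′) * (t * t - t′ * t′)
        u = num 2 * (s * t′ - s′ * t)
        v = (s - s′) * (t - t′)

        w²≡e²z : w * w ≡ e * e * z
        w²≡e²z = by₂ h h′ (solve 7 (λ c s s′ t t′ d e →
          let w = (s :- s′) :* (t :* t′ :+ e :* e) :+ κ 2 :* (t :- t′) :* d :* e
              z = κ 4 :* ((t :- t′) :* (t :- t′) :* (d :* d) :+ (s :- s′) :* (s :- s′) :* (e :* e))
                  :- (s :- s′) :* (s :- s′) :* ((t :- t′) :* (t :- t′)) :+ κ 2 :* (s :* s :- s′ :* s′) :* (t :* t :- t′ :* t′)
          in w :* w := e :* e :* z
            :+ (s :- s′) :* (t′ :* t′ :- e :* e) :* (c :* (t :* t :- e :* e) :- (κ 4 :* d :* e :* t :- s :* (t :* t) :- κ 3 :* s :* (e :* e)))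
            :+ (s′ :- s) :* (t :* t :- e :* e) :* (c :* (t′ :* t′ :- e :* e) :- (κ 4 :* d :* e :* t′ :- s′ :* (t′ :* t′) :- κ 3 :* s′ :* (e :* e))))
          refl c s s′ t t′ d e)

        ρ = s ∷ s′ ∷ t ∷ t′ ∷ d ∷ e ∷ []

        σρ : map σ ρ ≡ t ∷ t′ ∷ s ∷ s′ ∷ e ∷ - d ∷ []
        σρ = cong₂ _∷_ σs (cong₂ _∷_ σs′ (cong₂ _∷_ σt (cong₂ _∷_ σt′ (cong₂ _∷_ σd (cong₂ _∷_ σe refl)))))

        σz : σ z ≡ z
        σz = trans (σ-⟦⟧ endo (κ 4 :* ((var 2F :- var 3F) :* (var 2F :- var 3F) :* (var 4F :* var 4F) :+ (var 0F :- var 1F) :* (var 0F :- var 1F) :* (var 5F :* var 5F))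
                  :- (var 0F :- var 1F) :* (var 0F :- var 1F) :* ((var 2F :- var 3F) :* (var 2F :- var 3F)) :+ κ 2 :* (var 0F :* var 0F :- var 1F :* var 1F) :* (var 2F :* var 2F :- var 3F :* var 3F)) {ρ} σρ)
          (solve 6 (λ s s′ t t′ d e →
            κ 4 :* ((s :- s′) :* (s :- s′) :* (e :* e) :+ (t :- t′) :* (t :- t′) :* ((:- d) :* (:- d)))
                  :- (t :- t′) :* (t :- t′) :* ((s :- s′) :* (s :- s′)) :+ κ 2 :* (t :* t :- t′ :* t′) :* (s :* s :- s′ :* s′)
            := κ 4 :* ((t :- t′) :* (t :- t′) :* (d :* d) :+ (s :- s′) :* (s :- s′) :* (e :* e))
                  :- (s :- s′) :* (s :- s′) :* ((t :- t′) :* (t :- t′)) :+ κ 2 :* (s :* s :- s′ :* s′) :* (t :* t :- t′ :* t′)) refl s s′ t t′ d e)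

        σw : σ w ≡ w₁
        σw = trans (σ-⟦⟧ endo ((var 0F :- var 1F) :* (var 2F :* var 3F :+ var 5F :* var 5F) :+ κ 2 :* (var 2F :- var 3F) :* var 4F :* var 5F) {ρ} σρ)
          (solve 6 (λ s s′ t t′ d e → (t :- t′) :* (s :* s′ :+ (:- d) :* (:- d)) :+ κ 2 :* (s :- s′) :* e :* (:- d)
            := (t :- t′) :* (s :* s′ :+ d :* d) :- κ 2 :* (s :- s′) :* e :* d) refl s s′ t t′ d e)

        σw₁ : σ w₁ ≡ w
        σw₁ = trans (σ-⟦⟧ endo ((var 2F :- var 3F) :* (var 0F :* var 1F :+ var 4F :* var 4F) :- κ 2 :* (var 0F :- var 1F) :* var 5F :* var 4F) {ρ} σρ)
          (solve 6 (λ s s′ t t′ d e → (s :- s′) :* (t :* t′ :+ e :* e) :- κ 2 :* (t :- t′) :* (:- d) :* e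
            := (s :- s′) :* (t :* t′ :+ e :* e) :+ κ 2 :* (t :- t′) :* d :* e) refl s s′ t t′ d e)

        σu : σ u ≡ - u
        σu = trans (σ-⟦⟧ endo (κ 2 :* (var 0F :* var 3F :- var 1F :* var 2F)) {ρ} σρ)
          (solve 4 (λ s s′ t t′ → κ 2 :* (t :* s′ :- t′ :* s) := :- (κ 2 :* (s :* t′ :- s′ :* t))) refl s s′ t t′)

        σv : σ v ≡ v
        σv = trans (σ-⟦⟧ endo ((var 0F :- var 1F) :* (var 2F :- var 3F)) {ρ} σρ) (*-comm _ _)

      -- `square-of-anti` gives w = 0, whence its conjugate w₁ and then z vanish. The elements u and
      -- v are chosen so that v² - u² = z - 4 (s - s′) w - 4 (t - t′) w₁, which is now 0; as v is
      -- fixed and u antifixed, v = 0. The two factors of v are conjugate.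
      fibre-trace-unique : d ≢ 0# → s ≡ s′
      fibre-trace-unique d≢0 = [ difference≡0⇒≡ , (λ t-t′≡0 → trans (sym σt) (trans (cong σ (difference≡0⇒≡ t-t′≡0)) σt′)) ]′
        (zero-product (proj₁ (fixed²≡anti² endo σv σu v²≡u²)))
        where
        w≡0 : w ≡ 0#
        w≡0 = square-of-anti σz (trans (cong σ σw) σw₁) σd σe d≢0 w²≡e²z

        w₁≡0 : w₁ ≡ 0#
        w₁≡0 = trans (sym σw) (trans (cong σ w≡0) σ-0)

        e≢0 : e ≢ 0#
        e≢0 = subst (_≢ 0#) σd (σ-nonzero d≢0)

        z≡0 : z ≡ 0#
        z≡0 = *-cancelˡ (*-nonzero e≢0 e≢0) (trans (sym w²≡e²z) (trans (cong (_* w) w≡0) (trans (zeroˡ w) (sym (zeroʳ _)))))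

        v²≡u² : v * v ≡ u * u
        v²≡u² = by₃ w≡0 w₁≡0 z≡0 (solve 6 (λ s s′ t t′ d e →
          let w = (s :- s′) :* (t :* t′ :+ e :* e) :+ κ 2 :* (t :- t′) :* d :* e
              w₁ = (t :- t′) :* (s :* s′ :+ d :* d) :- κ 2 :* (s :- s′) :* e :* d
              z = κ 4 :* ((t :- t′) :* (t :- t′) :* (d :* d) :+ (s :- s′) :* (s :- s′) :* (e :* e))
                  :- (s :- s′) :* (s :- s′) :* ((t :- t′) :* (t :- t′)) :+ κ 2 :* (s :* s :- s′ :* s′) :* (t :* t :- t′ :* t′)
              u = κ 2 :* (s :* t′ :- s′ :* t)
              v = (s :- s′) :* (t :- t′)
          in v :* v := u :* u :+ (:- (κ 4 :* (s :- s′))) :* (w :- κ 0) :+ (:- (κ 4 :* (t :- t′))) :* (w₁ :- κ 0) :+ κ 1 :* (z :- κ 0))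
          refl s s′ t t′ d e)

    -- The relation says that T is y + σ² y for y = x σ³ x / σ x, cleared of denominators. On a
    -- fibre d = x - σ² x, e = σ d and C = s - 2 T are constant. If d = 0, both arguments are fixed
    -- by σ²; otherwise `fibre-trace-unique` makes s constant too, and s and d recover x.
    quartic-trace : ∀ {x x′ T T′} → σ (σ T) ≡ T → σ (σ T′) ≡ T′
      → T * (σ x * σ (σ (σ x))) ≡ x * σ (σ (σ x)) ^ 2 + σ (σ x) * σ x ^ 2
      → T′ * (σ x′ * σ (σ (σ x′))) ≡ x′ * σ (σ (σ x′)) ^ 2 + σ (σ x′) * σ x′ ^ 2
      → x - T ≡ x′ - T′ → x ≡ x′ ⊎ (σ (σ x) ≡ x × σ (σ x′) ≡ x′)
    quartic-trace {x} {x′} {T} {T′} σσT σσT′ hT hT′ eq = conclude (d ≟ 0#)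
      where
      a₁ = σ x
      a₂ = σ a₁
      a₃ = σ a₂
      a₁′ = σ x′
      a₂′ = σ a₁′
      a₃′ = σ a₂′
      s = x + a₂
      t = a₁ + a₃
      s′ = x′ + a₂′
      t′ = a₁′ + a₃′
      d = x - a₂
      e = a₁ - a₃

      σσeq : a₂ - T ≡ a₂′ - T′
      σσeq = trans (sym (σ-⟦⟧ (∘-endo endo endo) p (cong (λ t → a₂ ∷ t ∷ []) σσT)))
        (trans (cong (σ ∘ σ) eq) (σ-⟦⟧ (∘-endo endo endo) p (cong (λ t → a₂′ ∷ t ∷ []) σσT′)))
        where p = var 0F :- var 1F

      d≡d′ : d ≡ x′ - a₂′
      d≡d′ = by₂ eq σσeq (solve 6 (λ a b a′ b′ t t′ → a :- b :=
        a′ :- b′ :+ κ 1 :* (a :- t :- (a′ :- t′)) :+ con (negsuc 0) :* (b :- t :- (b′ :- t′))) refl x a₂ x′ a₂′ T T′)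

      C≡C′ : s - num 2 * T ≡ s′ - num 2 * T′
      C≡C′ = by₂ eq σσeq (solve 6 (λ a b a′ b′ t t′ → a :+ b :- κ 2 :* t :=
        a′ :+ b′ :- κ 2 :* t′ :+ κ 1 :* (a :- t :- (a′ :- t′)) :+ κ 1 :* (b :- t :- (b′ :- t′))) refl x a₂ x′ a₂′ T T′)

      σ- : ∀ a b → σ (a - b) ≡ σ a - σ b
      σ- a b = trans (σ-+ a (- b)) (cong (σ a +_) (σ-neg b))

      e≡e′ : e ≡ a₁′ - a₃′
      e≡e′ = trans (sym (σ- x a₂)) (trans (cong σ d≡d′) (σ- x′ a₂′))

      -- In terms of sums and differences, 4 a₁ a₃ = t² - e² and 4 (a a₃² + a₂ a₁²) = s (t² + e²) -
      -- 2 d e t.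
      invariant : ∀ {a a₁ a₂ a₃ T} → T * (a₁ * a₃) ≡ a * a₃ ^ 2 + a₂ * a₁ ^ 2
        → (a + a₂ - num 2 * T) * ((a₁ + a₃) * (a₁ + a₃) - (a₁ - a₃) * (a₁ - a₃))
        ≡ num 4 * (a - a₂) * (a₁ - a₃) * (a₁ + a₃) - (a + a₂) * ((a₁ + a₃) * (a₁ + a₃)) - num 3 * (a + a₂) * ((a₁ - a₃) * (a₁ - a₃))
      invariant {a} {a₁} {a₂} {a₃} {T} h = by₁ h (solve 5 (λ a a₁ a₂ a₃ T →
        (a :+ a₂ :- κ 2 :* T) :* ((a₁ :+ a₃) :* (a₁ :+ a₃) :- (a₁ :- a₃) :* (a₁ :- a₃))
        := κ 4 :* (a :- a₂) :* (a₁ :- a₃) :* (a₁ :+ a₃) :- (a :+ a₂) :* ((a₁ :+ a₃) :* (a₁ :+ a₃)) :- κ 3 :* (a :+ a₂) :* ((a₁ :- a₃) :* (a₁ :- a₃))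
           :+ con (negsuc 7) :* (T :* (a₁ :* a₃) :- (a :* a₃ :^ 2 :+ a₂ :* a₁ :^ 2))) refl a a₁ a₂ a₃ T)

      I′ : (s - num 2 * T) * (t′ * t′ - e * e) ≡ num 4 * d * e * t′ - s′ * (t′ * t′) - num 3 * s′ * (e * e)
      I′ = subst₂ (λ c d → c * (t′ * t′ - e * e) ≡ num 4 * d * e * t′ - s′ * (t′ * t′) - num 3 * s′ * (e * e)) (sym C≡C′) (sym d≡d′)
        (subst (λ e → (s′ - num 2 * T′) * (t′ * t′ - e * e) ≡ num 4 * (x′ - a₂′) * e * t′ - s′ * (t′ * t′) - num 3 * s′ * (e * e)) (sym e≡e′) (invariant hT′))

      σt : ∀ x → σ (σ x + σ (σ (σ x))) ≡ x + σ (σ x)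
      σt x = trans (σ-+ _ _) (trans (cong (σ (σ x) +_) (σ⁴ x)) (+-comm _ _))

      σe : σ e ≡ - d
      σe = trans (σ- a₁ a₃) (trans (cong (λ a → a₂ - a) (σ⁴ x)) (solve 2 (λ a b → b :- a := :- (a :- b)) refl x a₂))

      conclude : Dec (d ≡ 0#) → x ≡ x′ ⊎ (σ (σ x) ≡ x × σ (σ x′) ≡ x′)
      conclude (yes d≡0) = inj₂ (sym (difference≡0⇒≡ d≡0) , sym (difference≡0⇒≡ (trans (sym d≡d′) d≡0)))
      conclude (no d≢0) = inj₁ (sum-difference⇒≡ (fibre-trace-unique (σ-+ x a₂) (σt x) (σ-+ x′ a₂′) (σt x′)
        (σ- x a₂) σe (invariant hT) I′ d≢0) d≡d′)

-- Relations behind (c), (g) and (h)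

module RootTraces {size : ℕ} (F : FiniteField size) where
  open Field F
  open FieldEquations F
  open FiniteField F using (Carrier)
  open ≡-Reasoning

  module _ {σ} (endo : IsEndo σ) where
    open IsEndo endo

    -- Here c = x + y + σ y satisfies σ c * x = c * y, so c determines the ratio y / x.
    cube-root-trace : ∀ {x x′ y y′} → σ (σ y) ≡ y → σ (σ y′) ≡ y′
      → y ^ 3 ≡ x * (x * σ x) → y′ ^ 3 ≡ x′ * (x′ * σ x′) → y * σ y ≡ x * σ x → y′ * σ y′ ≡ x′ * σ x′
      → x + (σ y + y) ≡ x′ + (σ y′ + y′) → x ≡ x′ ⊎ (σ x ≡ x × σ x′ ≡ x′)
    cube-root-trace {x} {x′} {y} {y′} σσy σσy′ y³ y′³ yσy y′σy′ eq = conclude (c ≟ 0#)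
      where
      c = x + (σ y + y)

      y²≡xσy : ∀ {x y} → y ^ 3 ≡ x * (x * σ x) → y * σ y ≡ x * σ x → y * y ≡ x * σ y
      y²≡xσy {x} {y} y³ yσy = case (y ≟ 0#)
        where
        case : Dec (y ≡ 0#) → y * y ≡ x * σ y
        case (yes refl) = trans (zeroʳ 0#) (sym (trans (cong (x *_) σ-0) (zeroʳ x)))
        case (no y≢0) = *-cancelˡ y≢0 (by₂ y³ yσy (solve 4 (λ x y x₁ y₁ → y :* (y :* y) := y :* (x :* y₁)
          :+ κ 1 :* (y :^ 3 :- x :* (x :* x₁)) :+ (:- x) :* (y :* y₁ :- x :* x₁)) refl x y (σ x) (σ y)))

      σ-c : ∀ {x y} → σ (σ y) ≡ y → σ (x + (σ y + y)) ≡ σ x + (y + σ y)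
      σ-c {x} {y} σσy = σ-⟦⟧ endo (var 0F :+ (var 1F :+ var 2F)) {x ∷ σ y ∷ y ∷ []} (cong (λ z → σ x ∷ z ∷ σ y ∷ []) σσy)

      ratio : ∀ {x y} → σ (σ y) ≡ y → y * σ y ≡ x * σ x → y * y ≡ x * σ y
            → σ (x + (σ y + y)) * x ≡ (x + (σ y + y)) * y
      ratio {x} {y} σσy yσy y² = trans (cong (_* x) (σ-c σσy)) (by₂ yσy y² (solve 4 (λ x y x₁ y₁ →
        (x₁ :+ (y :+ y₁)) :* x := (x :+ (y₁ :+ y)) :* y :+ con (negsuc 0) :* (y :* y₁ :- x :* x₁)
          :+ con (negsuc 0) :* (y :* y :- x :* y₁)) refl x y (σ x) (σ y)))

      h : σ c * x ≡ c * y
      h = ratio σσy yσy (y²≡xσy y³ yσy)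

      h′ : σ c * x′ ≡ c * y′
      h′ = subst (λ z → σ z * x′ ≡ z * y′) (sym eq) (ratio σσy′ y′σy′ (y²≡xσy y′³ y′σy′))

      c≡0⇒fixed : ∀ {x y} → σ (σ y) ≡ y → x + (σ y + y) ≡ 0# → σ x ≡ x
      c≡0⇒fixed {x} {y} σσy c≡0 = by₂ (trans (sym (σ-c σσy)) (trans (cong σ c≡0) σ-0)) c≡0
        (solve 4 (λ x y x₁ y₁ → x₁ := x :+ κ 1 :* (x₁ :+ (y :+ y₁) :- κ 0) :+ con (negsuc 0) :* (x :+ (y₁ :+ y) :- κ 0))
          refl x y (σ x) (σ y))

      conclude : Dec (c ≡ 0#) → x ≡ x′ ⊎ (σ x ≡ x × σ x′ ≡ x′)
      conclude (yes c≡0) = inj₂ (c≡0⇒fixed σσy c≡0 , c≡0⇒fixed σσy′ (trans (sym eq) c≡0))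
      conclude (no c≢0) = inj₁ (sym (*-cancelˡ c≢0 cx′≡cx))
        where
        x≡0⇒c≡0 : ∀ {x y} → y ^ 3 ≡ x * (x * σ x) → x ≡ 0# → x + (σ y + y) ≡ 0#
        x≡0⇒c≡0 {x} {y} y³ refl = begin
          0# + (σ y + y)    ≡⟨ cong (λ y → 0# + (σ y + y)) (^≡0⇒≡0 3 (trans y³ (zeroˡ _))) ⟩
          0# + (σ 0# + 0#)  ≡⟨ cong (λ z → 0# + (z + 0#)) σ-0 ⟩
          0# + (0# + 0#)    ≡⟨ solve 0 (κ 0 :+ (κ 0 :+ κ 0) := κ 0) refl ⟩
          0#                ∎

        x≢0 : x ≢ 0#
        x≢0 = c≢0 ∘ x≡0⇒c≡0 y³

        x′≢0 : x′ ≢ 0#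
        x′≢0 = c≢0 ∘ trans eq ∘ x≡0⇒c≡0 y′³

        yx′≡y′x : y * x′ ≡ y′ * x
        yx′≡y′x = *-cancelˡ c≢0 (by₂ h h′ (solve 6 (λ c c₁ x x′ y y′ → c :* (y :* x′) := c :* (y′ :* x)
          :+ (:- x′) :* (c₁ :* x :- c :* y) :+ x :* (c₁ :* x′ :- c :* y′)) refl c (σ c) x x′ y y′))

        -- `y²≡xσy` says σ y / x = (y / x)². Equal ratios y / x thus give equal ratios σ y / x, and
        -- c / x = 1 + y / x + σ y / x then determines x.
        σyx′≡σy′x : σ y * x′ ≡ σ y′ * x
        σyx′≡σy′x = *-cancelˡ (*-nonzero x≢0 x′≢0) (by₃ (y²≡xσy y³ yσy) (y²≡xσy y′³ y′σy′) yx′≡y′x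
          (solve 6 (λ x x′ y y′ z z′ → x :* x′ :* (z :* x′) := x :* x′ :* (z′ :* x)
            :+ (:- (x′ :* x′)) :* (y :* y :- x :* z) :+ (x :* x) :* (y′ :* y′ :- x′ :* z′)
            :+ (y :* x′ :+ y′ :* x) :* (y :* x′ :- y′ :* x)) refl x x′ y y′ (σ y) (σ y′)))

        cx′≡cx : c * x′ ≡ c * x
        cx′≡cx = by₃ yx′≡y′x σyx′≡σy′x eq (solve 6 (λ x x′ y y′ z z′ → (x :+ (z :+ y)) :* x′ := (x :+ (z :+ y)) :* x
          :+ κ 1 :* (y :* x′ :- y′ :* x) :+ κ 1 :* (z :* x′ :- z′ :* x) :+ (:- x) :* (x :+ (z :+ y) :- (x′ :+ (z′ :+ y′))))
          refl x x′ y y′ (σ y) (σ y′))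

    module _ (2≢0 : num 2 ≢ 0#) (σ³ : ∀ x → σ (σ (σ x)) ≡ x) where
      open OddCharacteristic 2≢0

      -- With formal square roots a = α², b = β², c = ζ² of the conjugates of x one has
      -- x + Tr y = (α + β)(α + ζ), so the values at the conjugates of x determine (α + β)².
      square-root-trace : ∀ {x x′ y y′} → y * y ≡ x * σ (σ x) → y′ * y′ ≡ x′ * σ (σ x′)
        → y * (σ y * σ (σ y)) ≡ x * (σ x * σ (σ x)) → y′ * (σ y′ * σ (σ y′)) ≡ x′ * (σ x′ * σ (σ x′))
        → x + (σ (σ y) + (σ y + y)) ≡ x′ + (σ (σ y′) + (σ y′ + y′)) → x ≡ x′ ⊎ (σ x ≡ x × σ x′ ≡ x′)
      square-root-trace {x} {x′} {y} {y′} y² y′² Ny Ny′ eq = conclude (f x y ≟ 0#)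
        where
        f : Carrier → Carrier → Carrier
        f x y = x + (σ (σ y) + (σ y + y))

        σ-f : ∀ x y → σ (f x y) ≡ f (σ x) y
        σ-f x y = trans (σ-⟦⟧ endo (var 0F :+ (var 1F :+ (var 2F :+ var 3F))) {x ∷ σ (σ y) ∷ σ y ∷ y ∷ []} (cong (λ z → σ x ∷ z ∷ σ (σ y) ∷ σ y ∷ []) (σ³ y)))
          (solve 4 (λ x y y₁ y₂ → x :+ (y :+ (y₂ :+ y₁)) := x :+ (y₂ :+ (y₁ :+ y))) refl (σ x) y (σ y) (σ (σ y)))

        -- This is (α + β)², since y stands for α ζ and σ y for α β.
        r : Carrier → Carrier → Carrier
        r x y = x + σ x + num 2 * σ y

        module _ {x y} (y² : y * y ≡ x * σ (σ x)) (Ny : y * (σ y * σ (σ y)) ≡ x * (σ x * σ (σ x))) where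
          private
            a = x
            b = σ x
            c = σ (σ x)
            y₀ = y
            y₁ = σ y
            y₂ = σ (σ y)

            σ-square : ∀ {y a c} → y * y ≡ a * c → σ y * σ y ≡ σ a * σ c
            σ-square h = trans (sym (σ-* _ _)) (trans (cong σ h) (σ-* _ _))

          y₁² : y₁ * y₁ ≡ b * a
          y₁² = trans (σ-square y²) (cong (b *_) (σ³ x))

          y₂² : y₂ * y₂ ≡ c * b
          y₂² = σ-square y₁²

          -- The squares alone give only (y₀ y₁)² = (a y₂)²; the norm hypothesis `Ny` fixes the
          -- sign.
          y₀y₁ : y₀ * y₁ ≡ a * y₂
          y₀y₁ = case (y ≟ 0#)
            where
            case : Dec (y ≡ 0#) → y₀ * y₁ ≡ a * y₂
            case (yes y≡0) = trans (trans (cong (_* y₁) y≡0) (zeroˡ y₁))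
              (sym (trans (cong (a *_) (trans (cong (σ ∘ σ) y≡0) (trans (cong σ σ-0) σ-0))) (zeroʳ a)))
            case (no y≢0) = *-cancelˡ (σ-nonzero (σ-nonzero y≢0)) (by₂ Ny y₂² (solve 6 (λ a b c y₀ y₁ y₂ →
              y₂ :* (y₀ :* y₁) := y₂ :* (a :* y₂) :+ κ 1 :* (y₀ :* (y₁ :* y₂) :- a :* (b :* c)) :+ (:- a) :* (y₂ :* y₂ :- c :* b))
              refl a b c y₀ y₁ y₂))

          y₁y₂ : y₁ * y₂ ≡ b * y₀
          y₁y₂ = trans (sym (σ-* _ _)) (trans (cong σ y₀y₁) (trans (σ-* _ _) (cong (b *_) (σ³ y))))

          y₂y₀ : y₂ * y₀ ≡ c * y₁
          y₂y₀ = trans (cong (y₂ *_) (sym (σ³ y))) (trans (sym (σ-* _ _)) (trans (cong σ y₁y₂) (σ-* _ _)))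

          -- (α + β)(α + ζ) · (β + α)(β + ζ) = (ζ + α)(ζ + β) · (α + β)².
          f*f : f x y * f (σ x) y ≡ f (σ (σ x)) y * r x y
          f*f = by₂ y² y₂² (by₂ y₁² y₂y₀ (solve 6 (λ a b c y₀ y₁ y₂ →
            (a :+ (y₂ :+ (y₁ :+ y₀))) :* (b :+ (y₂ :+ (y₁ :+ y₀))) := (c :+ (y₂ :+ (y₁ :+ y₀))) :* (a :+ b :+ κ 2 :* y₁)
              :+ κ 1 :* (y₀ :* y₀ :- a :* c) :+ κ 1 :* (y₂ :* y₂ :- c :* b) :+ con (negsuc 0) :* (y₁ :* y₁ :- b :* a)
              :+ κ 2 :* (y₂ :* y₀ :- c :* y₁)) refl a b c y₀ y₁ y₂))

        fixed : ∀ {x y} → f x y ≡ 0# → σ x ≡ x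
        fixed {x} {y} h = +-cancelʳ _ _ _ (trans (sym (σ-f x y)) (trans (trans (cong σ h) σ-0) (sym h)))

        conclude : Dec (f x y ≡ 0#) → x ≡ x′ ⊎ (σ x ≡ x × σ x′ ≡ x′)
        conclude (yes f≡0) = inj₂ (fixed f≡0 , fixed (trans (sym eq) f≡0))
        conclude (no f≢0) = inj₁ (difference≡0⇒≡ (2*-cancel (2*-cancel 4a≡)))
          where
          eq₁ : f (σ x) y ≡ f (σ x′) y′
          eq₁ = trans (sym (σ-f x y)) (trans (cong σ eq) (σ-f x′ y′))

          eq₂ : f (σ (σ x)) y ≡ f (σ (σ x′)) y′
          eq₂ = trans (sym (σ-f _ y)) (trans (cong σ eq₁) (σ-f _ y′))

          r≡r′ : r x y ≡ r x′ y′
          r≡r′ = *-cancelˡ f₂≢0 (trans (sym (f*f y² Ny)) (trans (cong₂ _*_ eq eq₁) (trans (f*f y′² Ny′) (cong (_* r x′ y′) (sym eq₂)))))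
            where
            f₂≢0 : f (σ (σ x)) y ≢ 0#
            f₂≢0 = subst (_≢ 0#) (trans (cong σ (σ-f x y)) (σ-f (σ x) y)) (σ-nonzero (σ-nonzero f≢0))

          σ-r : ∀ x y → σ (r x y) ≡ r (σ x) (σ y)
          σ-r x y = σ-⟦⟧ endo (var 0F :+ var 1F :+ κ 2 :* var 2F) {x ∷ σ x ∷ σ y ∷ []} refl

          r₁≡r₁′ : r (σ x) (σ y) ≡ r (σ x′) (σ y′)
          r₁≡r₁′ = trans (sym (σ-r x y)) (trans (cong σ r≡r′) (σ-r x′ y′))

          r₂≡r₂′ : r (σ (σ x)) (σ (σ y)) ≡ r (σ (σ x′)) (σ (σ y′))
          r₂≡r₂′ = trans (sym (σ-r _ _)) (trans (cong σ r₁≡r₁′) (σ-r _ _))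

          -- The three values of `r` add up to 2 (a + b + c) + 2 (y₀ + y₁ + y₂), and the signed
          -- values of `f` to 2 (a - b - c) - 2 (y₀ + y₁ + y₂).
          4a : ∀ x y → num 2 * (num 2 * x) ≡ num 2 * f x y - num 2 * f (σ x) y - num 2 * f (σ (σ x)) y
                                            + r x y + r (σ x) (σ y) + r (σ (σ x)) (σ (σ y))
          4a x y = trans
            (solve 6 (λ a b c y₀ y₁ y₂ → κ 2 :* (κ 2 :* a) := κ 2 :* (a :+ (y₂ :+ (y₁ :+ y₀))) :- κ 2 :* (b :+ (y₂ :+ (y₁ :+ y₀)))
               :- κ 2 :* (c :+ (y₂ :+ (y₁ :+ y₀))) :+ (a :+ b :+ κ 2 :* y₁) :+ (b :+ c :+ κ 2 :* y₂) :+ (c :+ a :+ κ 2 :* y₀))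
               refl x (σ x) (σ (σ x)) y (σ y) (σ (σ y)))
            (cong₂ (λ a y₀ → num 2 * f x y - num 2 * f (σ x) y - num 2 * f (σ (σ x)) y
               + r x y + r (σ x) (σ y) + (σ (σ x) + a + num 2 * y₀)) (sym (σ³ x)) (sym (σ³ y)))

          4a≡4a′ : num 2 * (num 2 * x) ≡ num 2 * (num 2 * x′)
          4a≡4a′ = trans (4a x y) (trans
            (cong₂ _+_ (cong₂ _+_ (cong₂ _+_ (cong₂ (λ u v → u - v) (cong₂ (λ u v → num 2 * u - num 2 * v) eq eq₁) (cong (num 2 *_) eq₂)) r≡r′) r₁≡r₁′) r₂≡r₂′)
            (sym (4a x′ y′)))

          4a≡ : num 2 * (num 2 * (x - x′)) ≡ 0#
          4a≡ = by₁ 4a≡4a′ (solve 2 (λ x x′ → κ 2 :* (κ 2 :* (x :- x′)) := κ 0 :+ κ 1 :* (κ 2 :* (κ 2 :* x) :- κ 2 :* (κ 2 :* x′))) refl x x′)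

      -- For x′ = x + δ with conjugates a, b, c of x, the fibre equation becomes
      -- δ · ∏ (aδ + ab + ac - bc) = 0, the three factors being conjugate.
      inverse-trace : ∀ {x x′ T T′} → σ T ≡ T → σ T′ ≡ T′
        → T * (x * (σ x * σ (σ x))) ≡ (x * σ x) ^ 2 + (σ x * σ (σ x)) ^ 2 + (σ (σ x) * x) ^ 2
        → T′ * (x′ * (σ x′ * σ (σ x′))) ≡ (x′ * σ x′) ^ 2 + (σ x′ * σ (σ x′)) ^ 2 + (σ (σ x′) * x′) ^ 2
        → num 2 * x - T ≡ num 2 * x′ - T′ → x ≡ x′ ⊎ (σ x ≡ x × σ x′ ≡ x′)
      inverse-trace {x} {x′} {T} {T′} σT σT′ hT hT′ eq = conclude (zero-product factored)
        where
        a = x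
        b = σ x
        c = σ (σ x)
        δ = x′ - x

        2δ : num 2 * δ ≡ T′ - T
        2δ = by₁ eq (solve 4 (λ x x′ t t′ → κ 2 :* (x′ :- x) := t′ :- t :+ con (negsuc 0) :* (κ 2 :* x :- t :- (κ 2 :* x′ :- t′))) refl x x′ T T′)

        -- Since 2 δ is a difference of two traces, δ lies in the fixed field, and all conjugates of
        -- x are shifted by the same δ.
        σδ : σ δ ≡ δ
        σδ = *-cancelˡ 2≢0 (trans (sym (σ-⟦⟧ endo (κ 2 :* var 0F) {δ ∷ []} refl)) (trans (cong σ 2δ)
          (trans (σ-⟦⟧ endo (var 0F :- var 1F) {T′ ∷ T ∷ []} (cong₂ (λ t t′ → t ∷ t′ ∷ []) σT′ σT)) (sym 2δ))))

        x′≡ : x′ ≡ a + δ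
        x′≡ = solve 2 (λ x x′ → x′ := x :+ (x′ :- x)) refl x x′

        σx′≡ : σ x′ ≡ b + δ
        σx′≡ = trans (cong σ x′≡) (trans (σ-+ a δ) (cong (b +_) σδ))

        σσx′≡ : σ (σ x′) ≡ c + δ
        σσx′≡ = trans (cong σ σx′≡) (trans (σ-+ b δ) (cong (c +_) σδ))

        T′≡ : T′ ≡ T + num 2 * δ
        T′≡ = by₁ 2δ (solve 3 (λ t t′ δ → t′ := t :+ κ 2 :* δ :+ con (negsuc 0) :* (κ 2 :* δ :- (t′ :- t))) refl T T′ δ)

        hT″ : (T + num 2 * δ) * ((a + δ) * ((b + δ) * (c + δ)))
            ≡ ((a + δ) * (b + δ)) ^ 2 + ((b + δ) * (c + δ)) ^ 2 + ((c + δ) * (a + δ)) ^ 2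
        hT″ = begin
          (T + num 2 * δ) * ((a + δ) * ((b + δ) * (c + δ)))
            ≡⟨ cong₂ _*_ T′≡ (cong₂ _*_ x′≡ (cong₂ _*_ σx′≡ σσx′≡)) ⟨
          T′ * (x′ * (σ x′ * σ (σ x′)))
            ≡⟨ hT′ ⟩
          (x′ * σ x′) ^ 2 + (σ x′ * σ (σ x′)) ^ 2 + (σ (σ x′) * x′) ^ 2
            ≡⟨ cong₂ (λ u v → (u * v) ^ 2 + (v * σ (σ x′)) ^ 2 + (σ (σ x′) * u) ^ 2) x′≡ σx′≡ ⟩
          ((a + δ) * (b + δ)) ^ 2 + ((b + δ) * σ (σ x′)) ^ 2 + (σ (σ x′) * (a + δ)) ^ 2
            ≡⟨ cong (λ u → ((a + δ) * (b + δ)) ^ 2 + ((b + δ) * u) ^ 2 + (u * (a + δ)) ^ 2) σσx′≡ ⟩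
          ((a + δ) * (b + δ)) ^ 2 + ((b + δ) * (c + δ)) ^ 2 + ((c + δ) * (a + δ)) ^ 2 ∎

        φ₀ = a * δ + a * b + c * a - b * c
        φ₁ = b * δ + b * c + a * b - c * a
        φ₂ = c * δ + c * a + b * c - a * b

        factored : δ * (φ₀ * (φ₁ * φ₂)) ≡ 0#
        factored = by₂ hT hT″ (solve 5 (λ a b c δ t →
          δ :* ((a :* δ :+ a :* b :+ c :* a :- b :* c) :* ((b :* δ :+ b :* c :+ a :* b :- c :* a) :* (c :* δ :+ c :* a :+ b :* c :- a :* b)))
          := κ 0 :+ ((a :+ δ) :* ((b :+ δ) :* (c :+ δ))) :* (t :* (a :* (b :* c)) :- ((a :* b) :^ 2 :+ (b :* c) :^ 2 :+ (c :* a) :^ 2))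
             :+ (:- (a :* (b :* c))) :* ((t :+ κ 2 :* δ) :* ((a :+ δ) :* ((b :+ δ) :* (c :+ δ)))
               :- (((a :+ δ) :* (b :+ δ)) :^ 2 :+ ((b :+ δ) :* (c :+ δ)) :^ 2 :+ ((c :+ δ) :* (a :+ δ)) :^ 2))) refl a b c δ T)

        σρ : map σ (a ∷ b ∷ c ∷ δ ∷ []) ≡ b ∷ c ∷ a ∷ δ ∷ []
        σρ = cong₂ (λ u v → b ∷ c ∷ u ∷ v ∷ []) (σ³ x) σδ

        σφ₀ : σ φ₀ ≡ φ₁
        σφ₀ = σ-⟦⟧ endo (var 0F :* var 3F :+ var 0F :* var 1F :+ var 2F :* var 0F :- var 1F :* var 2F) σρ

        σφ₁ : σ φ₁ ≡ φ₂
        σφ₁ = σ-⟦⟧ endo (var 1F :* var 3F :+ var 1F :* var 2F :+ var 0F :* var 1F :- var 2F :* var 0F) σρ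

        σφ₂ : σ φ₂ ≡ φ₀
        σφ₂ = σ-⟦⟧ endo (var 2F :* var 3F :+ var 2F :* var 0F :+ var 1F :* var 2F :- var 0F :* var 1F) σρ

        σ-zero : ∀ {u v} → σ u ≡ v → u ≡ 0# → v ≡ 0#
        σ-zero σu u≡0 = trans (sym σu) (trans (cong σ u≡0) σ-0)

        from-φ₀ : φ₀ ≡ 0# → x ≡ x′ ⊎ (σ x ≡ x × σ x′ ≡ x′)
        from-φ₀ φ₀≡0 = case (a ≟ b)
          where
          case : Dec (a ≡ b) → x ≡ x′ ⊎ (σ x ≡ x × σ x′ ≡ x′)
          case (yes a≡b) = inj₂ (sym a≡b , trans σx′≡ (trans (cong (_+ δ) (sym a≡b)) (sym x′≡)))
          case (no a≢b) = inj₁ (sym (difference≡0⇒≡ δ≡0))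
            where
            a≢0 : a ≢ 0#
            a≢0 a≡0 = a≢b (trans a≡0 (sym (trans (cong σ a≡0) σ-0)))

            -- b φ₀ - a φ₁ is free of δ and factors as (a - b) (c (a + b) - a b). The conjugate of
            -- the second factor is φ₀ - a δ, so its vanishing forces δ = 0.
            harmonic : c * (a + b) - a * b ≡ 0#
            harmonic = [ (λ h → contradiction (difference≡0⇒≡ h) a≢b) , id ]′ (zero-product
              (by₂ φ₀≡0 (σ-zero σφ₀ φ₀≡0) (solve 4 (λ a b c δ → (a :- b) :* (c :* (a :+ b) :- a :* b) := κ 0
                :+ b :* (a :* δ :+ a :* b :+ c :* a :- b :* c :- κ 0) :+ (:- a) :* (b :* δ :+ b :* c :+ a :* b :- c :* a :- κ 0)) refl a b c δ)))

            σharmonic : a * (b + c) - b * c ≡ 0#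
            σharmonic = σ-zero (σ-⟦⟧ endo (var 2F :* (var 0F :+ var 1F) :- var 0F :* var 1F) σρ) harmonic

            δ≡0 : δ ≡ 0#
            δ≡0 = *-cancelˡ a≢0 (by₂ φ₀≡0 σharmonic (solve 4 (λ a b c δ → a :* δ := a :* κ 0
              :+ κ 1 :* (a :* δ :+ a :* b :+ c :* a :- b :* c :- κ 0) :+ con (negsuc 0) :* (a :* (b :+ c) :- b :* c :- κ 0)) refl a b c δ))

        conclude : δ ≡ 0# ⊎ φ₀ * (φ₁ * φ₂) ≡ 0# → x ≡ x′ ⊎ (σ x ≡ x × σ x′ ≡ x′)
        conclude (inj₁ δ≡0) = inj₁ (sym (difference≡0⇒≡ δ≡0))
        conclude (inj₂ h) = from-φ₀ ([ id , (λ h′ → [ σ-zero σφ₂ ∘ σ-zero σφ₁ , σ-zero σφ₂ ]′ (zero-product h′)) ]′ (zero-product h))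

-- Traces, the fixed field, and case (i)

module Trace {q n : ℕ} (F : FiniteField (q ℕ.^ n)) (pp : IsPrimePower q) where
  open Field F public
  open FieldEquations F public
  open FiniteField F using (Carrier) public
  open ≡-Reasoning

  σ : Carrier → Carrier
  σ = _^ q

  σ-endo : IsEndo σ
  σ-endo = frobenius n pp refl

  open IsEndo σ-endo public

  num-q : num q ≡ 0#
  num-q = ^≡0⇒≡0 n (trans (sym (num-^ q n)) size≡0)

  num-% : ∀ N c .{{_ : ℕ.NonZero c}} → num N ≡ 0# → num c ≡ 0# → num (N ℕ.% c) ≡ 0#
  num-% N c N≡0 c≡0 = begin
    num r                                  ≡⟨ +-identityʳ _ ⟨
    num r + 0#                             ≡⟨ cong (num r +_) (zeroʳ (num d)) ⟨
    num r + num d * 0#                     ≡⟨ cong (λ z → num r + num d * z) c≡0 ⟨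
    num r + num d * num c                  ≡⟨ cong (num r +_) (num-* d c) ⟨
    num r + num (d ℕ.* c)                  ≡⟨ num-+ r (d ℕ.* c) ⟨
    num (r ℕ.+ d ℕ.* c)                    ≡⟨ cong num (m≡m%n+[m/n]*n N c) ⟨
    num N                                  ≡⟨ N≡0 ⟩
    0#                                     ∎
    where
    r = N ℕ.% c
    d = N ℕ./ c

  num-1 : num 1 ≢ 0#
  num-1 = 1≢0 ∘ trans (sym (+-identityʳ 1#))

  -- Excludes small characteristics: if c vanished in the field along with N, so would the remainder
  -- 1.
  %≡1⇒num≢0 : ∀ N c .{{_ : ℕ.NonZero c}} → num N ≡ 0# → N ℕ.% c ≡ 1 → num c ≢ 0#
  %≡1⇒num≢0 N c N≡0 eq c≡0 = num-1 (subst (λ r → num r ≡ 0#) eq (num-% N c N≡0 c≡0))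

  σ-iterate : ∀ x i → σ (x ^ (q ℕ.^ i)) ≡ x ^ (q ℕ.^ suc i)
  σ-iterate x i = trans (sym (^-* x (q ℕ.^ i) q)) (cong (x ^_) (ℕP.*-comm (q ℕ.^ i) q))

  iterate-σ : ∀ x i → σ x ^ (q ℕ.^ i) ≡ x ^ (q ℕ.^ suc i)
  iterate-σ x i = sym (^-* x q (q ℕ.^ i))

  fixed-iterate : ∀ {x} → σ x ≡ x → ∀ i → x ^ (q ℕ.^ i) ≡ x
  fixed-iterate {x} σx zero    = *-identityʳ x
  fixed-iterate {x} σx (suc i) = trans (sym (σ-iterate x i)) (trans (cong σ (fixed-iterate σx i)) σx)

  -- Each block of r factors is absorbed by x * x ^ r = x ^ Q = x. No division takes place, so x = 0
  -- is included.
  fixed-^ : ∀ {x Q r} → x ^ Q ≡ x → Q ≡ suc r → ∀ j → x ^ suc (j ℕ.* r) ≡ x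
  fixed-^ {x} h refl zero = *-identityʳ x
  fixed-^ {x} {r = r} h refl (suc j) = begin
    x * x ^ (r ℕ.+ j ℕ.* r)     ≡⟨ cong (x *_) (^-+ x r _) ⟩
    x * (x ^ r * x ^ (j ℕ.* r)) ≡⟨ *-assoc _ _ _ ⟨
    x * x ^ r * x ^ (j ℕ.* r)   ≡⟨ cong (_* x ^ (j ℕ.* r)) h ⟩
    x * x ^ (j ℕ.* r)           ≡⟨ fixed-^ h refl j ⟩
    x                           ∎

  tr : ℕ → Carrier → Carrier
  tr = Tr F q

  tr-+ : ∀ i x y → tr i (x + y) ≡ tr i x + tr i y
  tr-+ zero    x y = sym (+-identityʳ 0#)
  tr-+ (suc i) x y = trans (cong₂ _+_ (IsEndo.σ-+ (^-endo {q} σ-endo i) x y) (tr-+ i x y))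
    (solve 4 (λ a b c d → a :+ b :+ (c :+ d) := a :+ c :+ (b :+ d)) refl _ _ _ _)

  tr-*ˡ : ∀ i {t} x → σ t ≡ t → tr i (t * x) ≡ t * tr i x
  tr-*ˡ zero    {t} x σt = sym (zeroʳ t)
  tr-*ˡ (suc i) {t} x σt = trans (cong₂ _+_
    (trans (*-^ t x (q ℕ.^ i)) (cong (_* x ^ (q ℕ.^ i)) (fixed-iterate σt i))) (tr-*ˡ i x σt)) (sym (distribˡ t _ _))

  tr-neg : ∀ i x → tr i (- x) ≡ - tr i x
  tr-neg zero    x = solve 0 (κ 0 := :- κ 0) refl
  tr-neg (suc i) x = trans (cong₂ _+_ (IsEndo.σ-neg (^-endo {q} σ-endo i) x) (tr-neg i x))
    (solve 2 (λ a b → :- a :+ :- b := :- (a :+ b)) refl _ _)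

  tr-split : ∀ i j x → tr (i ℕ.+ j) x ≡ tr i (x ^ (q ℕ.^ j)) + tr j x
  tr-split zero    j x = sym (+-identityˡ _)
  tr-split (suc i) j x = trans (cong₂ _+_
    (trans (cong (x ^_) (trans (ℕP.^-distribˡ-+-* q i j) (ℕP.*-comm (q ℕ.^ i) (q ℕ.^ j)))) (^-* x (q ℕ.^ j) (q ℕ.^ i))) (tr-split i j x))
    (sym (+-assoc _ _ _))

  σ-tr : ∀ i x → σ (tr i x) ≡ tr i (σ x)
  σ-tr zero    x = σ-0
  σ-tr (suc i) x = trans (σ-+ _ _) (cong₂ _+_ (trans (σ-iterate x i) (sym (iterate-σ x i))) (σ-tr i x))

  -- Both sides are the sum of x ^ (q ^ j) for j from 0 to i.
  tr-telescope : ∀ i x → tr i (σ x) + x ≡ x ^ (q ℕ.^ i) + tr i x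
  tr-telescope zero    x = trans (+-comm _ _) (cong (_+ 0#) (sym (*-identityʳ x)))
  tr-telescope (suc i) x = begin
    σ x ^ (q ℕ.^ i) + tr i (σ x) + x                 ≡⟨ +-assoc _ _ _ ⟩
    σ x ^ (q ℕ.^ i) + (tr i (σ x) + x)               ≡⟨ cong₂ _+_ (iterate-σ x i) (tr-telescope i x) ⟩
    x ^ (q ℕ.^ suc i) + (x ^ (q ℕ.^ i) + tr i x)     ∎

  tr-σ : ∀ x → tr n (σ x) ≡ tr n x
  tr-σ x = +-cancelʳ x _ _ (trans (tr-telescope n x) (trans (cong (_+ tr n x) (fermat x)) (+-comm _ _)))

  tr-fixed : ∀ x → σ (tr n x) ≡ tr n x
  tr-fixed x = trans (σ-tr n x) (tr-σ x)

  tr-of-fixed : ∀ i {x} → σ x ≡ x → tr i x ≡ num i * x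
  tr-of-fixed zero    {x} σx = sym (zeroˡ x)
  tr-of-fixed (suc i) {x} σx = trans (cong₂ _+_ (trans (fixed-iterate σx i) (sym (*-identityˡ x))) (tr-of-fixed i σx)) (sym (distribʳ x 1# (num i)))

  tr-iterate : ∀ i x → tr n (x ^ (q ℕ.^ i)) ≡ tr n x
  tr-iterate zero    x = cong (tr n) (*-identityʳ x)
  tr-iterate (suc i) x = trans (cong (tr n) (sym (σ-iterate x i))) (trans (tr-σ _) (tr-iterate i x))

  tr₂ : ∀ x → tr 2 x ≡ σ x + x
  tr₂ x = cong₂ _+_ (cong (x ^_) (ℕP.*-identityʳ q)) (trans (+-identityʳ _) (*-identityʳ x))

  σσ-iterate : ∀ x → σ (σ x) ≡ x ^ (q ℕ.^ 2)
  σσ-iterate x = trans (sym (^-* x q q)) (cong (λ j → x ^ (q ℕ.* j)) (sym (ℕP.*-identityʳ q)))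

  tr₃ : ∀ x → tr 3 x ≡ σ (σ x) + (σ x + x)
  tr₃ x = cong₂ _+_ (sym (σσ-iterate x)) (tr₂ x)

  -- On the subfield of fixed points of σ the map is multiplication by 1 + n γ.
  injective-from-generic : ∀ {k γ r} j → q ≡ suc r → k ≡ suc (j ℕ.* r) → num 1 + γ * num n ≢ 0#
    → let f = λ x → x + γ * tr n (x ^ k) in
      (∀ {x x′} → f x ≡ f x′ → x ≡ x′ ⊎ (σ x ≡ x × σ x′ ≡ x′)) → Injective _≡_ _≡_ f
  injective-from-generic {k} {γ} j q≡ k≡ c≢0 generic {x} {x′} eq = [ id , (λ (σx , σx′) →
    *-cancelˡ c≢0 (trans (sym (on-fixed σx)) (trans eq (on-fixed σx′)))) ]′ (generic eq)
    where
    on-fixed : ∀ {x} → σ x ≡ x → x + γ * tr n (x ^ k) ≡ (num 1 + γ * num n) * x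
    on-fixed {x} σx = begin
      x + γ * tr n (x ^ k)       ≡⟨ cong (λ y → x + γ * tr n y) (trans (cong (x ^_) k≡) (fixed-^ σx q≡ j)) ⟩
      x + γ * tr n x             ≡⟨ cong (λ y → x + γ * y) (tr-of-fixed n σx) ⟩
      x + γ * (num n * x)        ≡⟨ solve 3 (λ x g n → x :+ g :* (n :* x) := (κ 1 :+ g :* n) :* x) refl x γ (num n) ⟩
      (num 1 + γ * num n) * x    ∎

  -- For τ = x ↦ x ^ (q ^ ℓ) the condition on γ says τ² γ = - γ. In x τ x the term linear in t is
  -- therefore t (z - τ z), killed by the invariance of the trace under τ. The quadratic term is t²
  -- w with τ w = - w. Since t lies in F_q, it can be taken out of the trace.
  case-i-injective : ∀ ℓ r {γ} → n ≡ 2 ℕ.* ℓ ℕ.* r → γ ^ (q ℕ.^ (2 ℕ.* ℓ) ℕ.∸ 1) ≡ - 1#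
    → Injective _≡_ _≡_ (λ x → x + γ * tr n (x ^ (q ℕ.^ ℓ ℕ.+ 1)))
  case-i-injective ℓ r {γ} n≡ γ-cond {x} {x′} eq = trans x≡ (trans (cong (λ t → x′ + γ * t) t≡0)
      (solve 2 (λ x g → x :+ g :* κ 0 := x) refl x′ γ))
    where
    τ : Carrier → Carrier
    τ = _^ (q ℕ.^ ℓ)

    τ-endo : IsEndo τ
    τ-endo = ^-endo {q} σ-endo ℓ

    module τ = IsEndo τ-endo

    instance
      q≢0 : ℕ.NonZero q
      q≢0 = primePower-nonZero pp

    ττγ : τ (τ γ) ≡ - γ
    ττγ = begin
      τ (τ γ)                         ≡⟨ ^-* γ (q ℕ.^ ℓ) (q ℕ.^ ℓ) ⟨
      γ ^ (q ℕ.^ ℓ ℕ.* q ℕ.^ ℓ)       ≡⟨ cong (γ ^_) (trans (sym (ℕP.^-distribˡ-+-* q ℓ ℓ)) (cong (λ j → q ℕ.^ (ℓ ℕ.+ j)) (sym (ℕP.+-identityʳ ℓ)))) ⟩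
      γ ^ (q ℕ.^ (2 ℕ.* ℓ))           ≡⟨ cong (γ ^_) (ℕP.m+[n∸m]≡n (ℕP.m^n>0 q (2 ℕ.* ℓ))) ⟨
      γ * γ ^ (q ℕ.^ (2 ℕ.* ℓ) ℕ.∸ 1) ≡⟨ cong (γ *_) γ-cond ⟩
      γ * - 1#                        ≡⟨ solve 2 (λ g o → g :* (:- o) := :- (g :* o)) refl γ 1# ⟩
      - (γ * 1#)                      ≡⟨ cong -_ (*-identityʳ γ) ⟩
      - γ                             ∎

    power : ∀ x → x ^ (q ℕ.^ ℓ ℕ.+ 1) ≡ x * τ x
    power x = cong (x ^_) (ℕP.+-comm (q ℕ.^ ℓ) 1)

    T T′ t z w : Carrier
    T = tr n (x ^ (q ℕ.^ ℓ ℕ.+ 1))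
    T′ = tr n (x′ ^ (q ℕ.^ ℓ ℕ.+ 1))
    t = T′ - T
    z = x′ * τ γ
    w = γ * τ γ

    σt : σ t ≡ t
    σt = trans (σ-+ _ _) (cong₂ _+_ (tr-fixed _) (trans (σ-neg _) (cong -_ (tr-fixed _))))

    x≡ : x ≡ x′ + γ * t
    x≡ = by₁ eq (solve 5 (λ x x′ g T T′ → x := x′ :+ g :* (T′ :- T) :+ κ 1 :* (x :+ g :* T :- (x′ :+ g :* T′))) refl x x′ γ T T′)

    τx≡ : τ x ≡ τ x′ + τ γ * t
    τx≡ = trans (cong τ x≡) (trans (τ.σ-+ _ _) (cong (τ x′ +_) (trans (τ.σ-* _ _) (cong (τ γ *_) (fixed-iterate σt ℓ)))))

    τz : τ z ≡ - (γ * τ x′)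
    τz = trans (τ.σ-* _ _) (trans (cong (τ x′ *_) ττγ) (solve 2 (λ x g → x :* (:- g) := :- (g :* x)) refl (τ x′) γ))

    τw : τ w ≡ - w
    τw = trans (τ.σ-* _ _) (trans (cong (τ γ *_) ττγ) (solve 2 (λ x g → x :* (:- g) := :- (g :* x)) refl (τ γ) γ))

    -- The 2 ℓ conjugates of v pair off as u and τ u = - u.
    tr-anti : ∀ {v} → τ v ≡ - v → tr (2 ℕ.* ℓ) v ≡ 0#
    tr-anti {v} τv = begin
      tr (2 ℕ.* ℓ) v        ≡⟨ cong (λ j → tr (ℓ ℕ.+ j) v) (ℕP.+-identityʳ ℓ) ⟩
      tr (ℓ ℕ.+ ℓ) v        ≡⟨ tr-split ℓ ℓ v ⟩
      tr ℓ (τ v) + tr ℓ v   ≡⟨ cong (λ u → tr ℓ u + tr ℓ v) τv ⟩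
      tr ℓ (- v) + tr ℓ v   ≡⟨ cong (_+ tr ℓ v) (tr-neg ℓ v) ⟩
      - tr ℓ v + tr ℓ v     ≡⟨ -‿inverseˡ _ ⟩
      0#                    ∎

    tr-anti-multiple : ∀ r {v} → τ v ≡ - v → tr (r ℕ.* (2 ℕ.* ℓ)) v ≡ 0#
    tr-anti-multiple zero    τv = refl
    tr-anti-multiple (suc r) {v} τv = trans (tr-split (2 ℕ.* ℓ) j v)
      (trans (cong₂ _+_ (tr-anti τρv) (tr-anti-multiple r τv)) (+-identityʳ 0#))
      where
      j = r ℕ.* (2 ℕ.* ℓ)

      τρv : τ (v ^ (q ℕ.^ j)) ≡ - (v ^ (q ℕ.^ j))
      τρv = trans (τ.σ-^ v (q ℕ.^ j)) (trans (cong (_^ (q ℕ.^ j)) τv) (IsEndo.σ-neg (^-endo {q} σ-endo j) v))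

    tr-w : tr n w ≡ 0#
    tr-w = trans (cong (λ j → tr j w) (trans n≡ (ℕP.*-comm (2 ℕ.* ℓ) r))) (tr-anti-multiple r τw)

    expand : x * τ x ≡ x′ * τ x′ + t * (z + - τ z) + t * (t * w)
    expand = begin
      x * τ x                                          ≡⟨ cong₂ _*_ x≡ τx≡ ⟩
      (x′ + γ * t) * (τ x′ + τ γ * t)                  ≡⟨ solve 5 (λ x y g h t → (x :+ g :* t) :* (y :+ h :* t)
                                                            := x :* y :+ t :* (x :* h :+ :- (:- (g :* y))) :+ t :* (t :* (g :* h))) refl x′ (τ x′) γ (τ γ) t ⟩
      x′ * τ x′ + t * (z + - - (γ * τ x′)) + t * (t * w) ≡⟨ cong (λ u → x′ * τ x′ + t * (z + - u) + t * (t * w)) τz ⟨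
      x′ * τ x′ + t * (z + - τ z) + t * (t * w)        ∎

    T≡T′ : T ≡ T′
    T≡T′ = begin
      tr n (x ^ (q ℕ.^ ℓ ℕ.+ 1))                                         ≡⟨ cong (tr n) (trans (power x) expand) ⟩
      tr n (x′ * τ x′ + t * (z + - τ z) + t * (t * w))                   ≡⟨ trans (tr-+ n _ _) (cong (_+ tr n (t * (t * w))) (tr-+ n _ _)) ⟩
      tr n (x′ * τ x′) + tr n (t * (z + - τ z)) + tr n (t * (t * w))     ≡⟨ cong₂ (λ u v → u + tr n (t * (z + - τ z)) + v)
                                                                              (cong (tr n) (sym (power x′)))
                                                                              (trans (tr-*ˡ n _ σt) (cong (t *_) (trans (tr-*ˡ n _ σt) (cong (t *_) tr-w)))) ⟩
      T′ + tr n (t * (z + - τ z)) + t * (t * 0#)                         ≡⟨ cong (λ u → T′ + u + t * (t * 0#)) (trans (tr-*ˡ n _ σt) (cong (t *_) (trans (tr-+ n _ _)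
                                                                              (cong (tr n z +_) (trans (tr-neg n _) (cong -_ (tr-iterate ℓ z))))))) ⟩
      T′ + t * (tr n z + - tr n z) + t * (t * 0#)                        ≡⟨ solve 3 (λ T t z → T :+ t :* (z :+ :- z) :+ t :* (t :* κ 0) := T) refl T′ t (tr n z) ⟩
      T′                                                                 ∎

    t≡0 : t ≡ 0#
    t≡0 = trans (cong (λ u → T′ - u) T≡T′) (-‿inverseʳ T′)

-- Degree two: cases (a), (b) and (c)

module Quadratic {q : ℕ} (F : FiniteField (q ℕ.^ 2)) (pp : IsPrimePower q) where
  open Trace {q} {2} F pp
  open ≡-Reasoning

  σσ : ∀ x → σ (σ x) ≡ x
  σσ x = trans (σσ-iterate x) (fermat x)

  q∸1 : ℕ
  q∸1 = ℕ.pred q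

  q≡ : q ≡ suc q∸1
  q≡ = sym (ℕP.suc-pred q {{primePower-nonZero pp}})

  2q∸1≡ : 2 ℕ.* q ℕ.∸ 1 ≡ suc (2 ℕ.* q∸1)
  2q∸1≡ = trans (cong (λ q → 2 ℕ.* q ℕ.∸ 1) q≡) (ℕP.+-suc q∸1 (q∸1 ℕ.+ 0))

  -- For remainder 5, both 5 and 6 would vanish, hence also their difference 1.
  num-6 : (q ℕ.% 6 ≡ 1 ⊎ q ℕ.% 6 ≡ 5) → num 6 ≢ 0#
  num-6 (inj₁ q%6) = %≡1⇒num≢0 q 6 num-q q%6
  num-6 (inj₂ q%6) 6≡0 = num-1 (by₂ 6≡0 (subst (λ r → num r ≡ 0#) q%6 (num-% q 6 num-q 6≡0))
    (solve 0 (κ 1 := κ 0 :+ κ 1 :* (κ 6 :- κ 0) :+ con (negsuc 0) :* (κ 5 :- κ 0)) refl))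

  num-factorˡ : ∀ m n → num (m ℕ.* n) ≢ 0# → num m ≢ 0#
  num-factorˡ m n mn≢0 m≡0 = mn≢0 (trans (num-* m n) (trans (cong (_* num n) m≡0) (zeroˡ _)))

  case-a-injective : ∀ {γ} → (q ℕ.% 6 ≡ 1 ⊎ q ℕ.% 6 ≡ 5) → num 3 * γ ≡ - 1#
    → Injective _≡_ _≡_ (λ x → x + γ * tr 2 (x ^ (2 ℕ.* q ℕ.∸ 1)))
  case-a-injective {γ} q%6 3γ = injective-from-generic 2 q≡ 2q∸1≡ coefficient generic
    where
    open OddCharacteristic (num-factorˡ 2 3 (num-6 q%6))
    open Order2 σ-endo σσ

    k = 2 ℕ.* q ℕ.∸ 1

    hγ : num 3 * γ ≡ - num 1
    hγ = trans 3γ (cong -_ (sym (+-identityʳ 1#)))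

    -- By 3 γ = - 1, three times this coefficient is 1.
    coefficient : num 1 + γ * num 2 ≢ 0#
    coefficient h = num-1 (by₂ h hγ (solve 1 (λ g → κ 1 := κ 0 :+ κ 3 :* (κ 1 :+ g :* κ 2 :- κ 0)
      :+ (:- κ 2) :* (κ 3 :* g :- (:- κ 1))) refl γ))

    x^k*x : ∀ x → x ^ k * x ≡ σ x * σ x
    x^k*x x = begin
      x ^ k * x          ≡⟨ *-comm _ _ ⟩
      x ^ suc k          ≡⟨ cong (x ^_) (trans (cong suc 2q∸1≡) (trans (ℕ-Solver.solve 1 (λ r → con′ 2 :+′ (con′ 2 :*′ r) :=′ (con′ 1 :+′ r) :+′ (con′ 1 :+′ r)) refl q∸1)
                              (sym (cong₂ ℕ._+_ q≡ q≡)))) ⟩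
      x ^ (q ℕ.+ q)      ≡⟨ ^-+ x q q ⟩
      σ x * σ x          ∎

    trace : ∀ x → tr 2 (x ^ k) * (x * σ x) ≡ x ^ 3 + σ x ^ 3
    trace x = trans (cong (_* (x * σ x)) (tr₂ (x ^ k))) (by₂ (x^k*x x) σ-x^k*x
      (solve 4 (λ a b y z → (z :+ y) :* (a :* b) := a :^ 3 :+ b :^ 3 :+ b :* (y :* a :- b :* b) :+ a :* (z :* b :- a :* a))
        refl x (σ x) (x ^ k) (σ (x ^ k))))
      where
      σ-x^k*x : σ (x ^ k) * σ x ≡ x * x
      σ-x^k*x = trans (sym (σ-* _ _)) (trans (cong σ (x^k*x x)) (trans (σ-* _ _) (cong₂ _*_ (σσ x) (σσ x))))

    generic : ∀ {x x′} → x + γ * tr 2 (x ^ k) ≡ x′ + γ * tr 2 (x′ ^ k) → x ≡ x′ ⊎ (σ x ≡ x × σ x′ ≡ x′)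
    generic {x} {x′} eq = cubic-trace (num-factorˡ 3 2 (num-6 q%6)) (tr-fixed _) (tr-fixed _) (trace x) (trace x′)
      (by₂ eq hγ (solve 5 (λ x x′ g t t′ → κ 3 :* x :- t := κ 3 :* x′ :- t′ :+ κ 3 :* (x :+ g :* t :- (x′ :+ g :* t′))
        :+ (t′ :- t) :* (κ 3 :* g :- (:- κ 1))) refl x x′ γ (tr 2 (x ^ k)) (tr 2 (x′ ^ k))))

  -- ω = - 3 γ is a cube root of unity and 3 divides k, so x ↦ ω x conjugates this case to the previous one.
  case-b-injective : ∀ {γ} → q ℕ.% 6 ≡ 5 → num 27 * γ ^ 3 ≡ - 1#
    → Injective _≡_ _≡_ (λ x → x + γ * tr 2 (x ^ (2 ℕ.* q ℕ.∸ 1)))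
  case-b-injective {γ} q%6 27γ³ {x} {x′} eq = *-cancelˡ ω²≢0 (case-a-injective (inj₂ q%6) 3γ₀ (*-cancelˡ ω≢0
    (trans (sym (conjugated x)) (trans eq (conjugated x′)))))
    where
    k = 2 ℕ.* q ℕ.∸ 1
    j = q ℕ./ 6
    third = invertible (num-factorˡ 3 2 (num-6 (inj₂ q%6)))
    γ₀ = - proj₁ third
    ω = - (num 3 * γ)

    3γ₀ : num 3 * γ₀ ≡ - 1#
    3γ₀ = trans (solve 2 (λ t a → t :* (:- a) := :- (a :* t)) refl (num 3) (proj₁ third)) (cong -_ (proj₂ third))

    ω³ : ω ^ 3 ≡ 1#
    ω³ = trans (solve 1 (λ g → (:- (κ 3 :* g)) :^ 3 := :- (κ 27 :* g :^ 3)) refl γ)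
      (trans (cong -_ 27γ³) (-‿involutive 1#))

    ω≢0 : ω ≢ 0#
    ω≢0 ω≡0 = 1≢0 (trans (sym ω³) (trans (cong (_^ 3) ω≡0) (zeroˡ _)))

    ω²≢0 : ω * ω ≢ 0#
    ω²≢0 = *-nonzero ω≢0 ω≢0

    ωγ₀ : ω * γ₀ ≡ γ
    ωγ₀ = by₁ (trans 3γ₀ (cong -_ (sym (+-identityʳ 1#)))) (solve 2 (λ g h → (:- (κ 3 :* g)) :* h := g :+ (:- g) :* (κ 3 :* h :- (:- κ 1))) refl γ γ₀)

    -- q = 6 j + 5 gives k = 12 j + 9.
    k≡ : k ≡ 3 ℕ.* (3 ℕ.+ 4 ℕ.* j)
    k≡ = trans (cong (λ q → 2 ℕ.* q ℕ.∸ 1) (trans (m≡m%n+[m/n]*n q 6) (cong (ℕ._+ j ℕ.* 6) q%6)))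
      (ℕ-Solver.solve 1 (λ j → con′ 4 :+′ j :*′ con′ 6 :+′ (con′ 5 :+′ j :*′ con′ 6 :+′ con′ 0) :=′ con′ 3 :*′ (con′ 3 :+′ con′ 4 :*′ j)) refl j)

    ω^k : ω ^ k ≡ 1#
    ω^k = trans (cong (ω ^_) k≡) (trans (^-* ω 3 (3 ℕ.+ 4 ℕ.* j)) (trans (cong (_^ (3 ℕ.+ 4 ℕ.* j)) ω³) (1^ (3 ℕ.+ 4 ℕ.* j))))

    scaled-power : ∀ x → (ω * ω * x) ^ k ≡ x ^ k
    scaled-power x = begin
      (ω * ω * x) ^ k         ≡⟨ *-^ (ω * ω) x k ⟩
      (ω * ω) ^ k * x ^ k     ≡⟨ cong (_* x ^ k) (trans (*-^ ω ω k) (trans (cong₂ _*_ ω^k ω^k) (*-identityˡ 1#))) ⟩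
      1# * x ^ k              ≡⟨ *-identityˡ _ ⟩
      x ^ k                   ∎

    -- `ω * ω` is the inverse of ω, and it disappears inside the power because `ω^k` is 1.
    conjugated : ∀ x → x + γ * tr 2 (x ^ k) ≡ ω * (ω * ω * x + γ₀ * tr 2 ((ω * ω * x) ^ k))
    conjugated x = sym (begin
      ω * (ω * ω * x + γ₀ * tr 2 ((ω * ω * x) ^ k))  ≡⟨ cong (λ y → ω * (ω * ω * x + γ₀ * tr 2 y)) (scaled-power x) ⟩
      ω * (ω * ω * x + γ₀ * t)                       ≡⟨ by₂ (trans ω³ (sym (+-identityʳ 1#))) ωγ₀ (solve 5 (λ x t w g h →
                                                          w :* (w :* w :* x :+ h :* t) := x :+ g :* t :+ x :* (w :^ 3 :- κ 1) :+ t :* (w :* h :- g)) refl x t ω γ γ₀) ⟩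
      x + γ * t                                      ∎)
      where t = tr 2 (x ^ k)

  norm-fixed : ∀ x → σ (x * σ x) ≡ x * σ x
  norm-fixed x = trans (σ-* _ _) (trans (cong (σ x *_) (σσ x)) (*-comm _ _))

  -- Since 3 k = q² + q + 1 and x ^ (q²) = x, the power y = x ^ k is a cube root of x² σ x, as
  -- `cube-root-trace` requires.
  case-c-injective : ∀ {γ} → q ℕ.% 3 ≡ 1 → γ ≡ 1#
    → Injective _≡_ _≡_ (λ x → x + γ * tr 2 (x ^ ((q ℕ.^ 2 ℕ.+ q ℕ.+ 1) ℕ./ 3)))
  case-c-injective {γ} q%3 γ≡1 = injective-from-generic (1 ℕ.+ m) q≡1+m*3 k≡ coefficient generic
    where
    open RootTraces F using (cube-root-trace)

    k = (q ℕ.^ 2 ℕ.+ q ℕ.+ 1) ℕ./ 3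
    m = q ℕ./ 3

    q≡1+m*3 : q ≡ suc (m ℕ.* 3)
    q≡1+m*3 = trans (m≡m%n+[m/n]*n q 3) (cong (ℕ._+ m ℕ.* 3) q%3)

    3k′≡ : q ℕ.^ 2 ℕ.+ q ℕ.+ 1 ≡ suc ((1 ℕ.+ m) ℕ.* (m ℕ.* 3)) ℕ.* 3
    3k′≡ = trans (cong (λ q → q ℕ.^ 2 ℕ.+ q ℕ.+ 1) q≡1+m*3) (ℕ-Solver.solve 1 (λ m →
      (con′ 1 :+′ m :*′ con′ 3) :^′ 2 :+′ (con′ 1 :+′ m :*′ con′ 3) :+′ con′ 1
      :=′ (con′ 1 :+′ (con′ 1 :+′ m) :*′ (m :*′ con′ 3)) :*′ con′ 3) refl m)

    k≡ : k ≡ suc ((1 ℕ.+ m) ℕ.* (m ℕ.* 3))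
    k≡ = trans (cong (ℕ._/ 3) 3k′≡) (m*n/n≡m (suc ((1 ℕ.+ m) ℕ.* (m ℕ.* 3))) 3)

    coefficient : num 1 + γ * num 2 ≢ 0#
    coefficient h = %≡1⇒num≢0 q 3 num-q q%3 (by₂ h (trans γ≡1 (sym (+-identityʳ 1#)))
      (solve 1 (λ g → κ 3 := κ 0 :+ κ 1 :* (κ 1 :+ g :* κ 2 :- κ 0) :+ (:- κ 2) :* (g :- κ 1)) refl γ))

    y³ : ∀ x → (x ^ k) ^ 3 ≡ x * (x * σ x)
    y³ x = begin
      (x ^ k) ^ 3                  ≡⟨ ^-* x k 3 ⟨
      x ^ (k ℕ.* 3)                ≡⟨ cong (x ^_) (trans (cong (ℕ._* 3) k≡) (sym 3k′≡)) ⟩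
      x ^ (q ℕ.^ 2 ℕ.+ q ℕ.+ 1)    ≡⟨ trans (^-+ x (q ℕ.^ 2 ℕ.+ q) 1) (cong₂ _*_ (^-+ x (q ℕ.^ 2) q) (*-identityʳ x)) ⟩
      x ^ (q ℕ.^ 2) * σ x * x      ≡⟨ cong (λ u → u * σ x * x) (fermat x) ⟩
      x * σ x * x                  ≡⟨ solve 2 (λ x y → x :* y :* x := x :* (x :* y)) refl x (σ x) ⟩
      x * (x * σ x)                ∎

    -- The norm lies in F_q and k ≡ 1 modulo q - 1, so its k-th power is itself.
    yσy : ∀ x → x ^ k * σ (x ^ k) ≡ x * σ x
    yσy x = begin
      x ^ k * σ (x ^ k)    ≡⟨ cong (x ^ k *_) (σ-^ x k) ⟩
      x ^ k * σ x ^ k      ≡⟨ *-^ x (σ x) k ⟨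
      (x * σ x) ^ k        ≡⟨ cong ((x * σ x) ^_) k≡ ⟩
      (x * σ x) ^ suc ((1 ℕ.+ m) ℕ.* (m ℕ.* 3)) ≡⟨ fixed-^ (norm-fixed x) q≡1+m*3 (1 ℕ.+ m) ⟩
      x * σ x              ∎

    value : ∀ x → x + γ * tr 2 (x ^ k) ≡ x + (σ (x ^ k) + x ^ k)
    value x = cong (x +_) (trans (cong₂ _*_ γ≡1 (tr₂ _)) (*-identityˡ _))

    generic : ∀ {x x′} → x + γ * tr 2 (x ^ k) ≡ x′ + γ * tr 2 (x′ ^ k) → x ≡ x′ ⊎ (σ x ≡ x × σ x′ ≡ x′)
    generic {x} {x′} eq = cube-root-trace σ-endo (σσ _) (σσ _) (y³ x) (y³ x′) (yσy x) (yσy x′)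
      (trans (sym (value x)) (trans eq (value x′)))

-- Case (d): squares and nonsquares

module CaseD {q : ℕ} (F : FiniteField (q ℕ.^ 2)) (pp : IsPrimePower q) (q%4 : q ℕ.% 4 ≡ 1) where
  open Trace {q} {2} F pp
  open Quadratic F pp using (num-factorˡ)
  open OddCharacteristic (num-factorˡ 2 2 (%≡1⇒num≢0 q 4 num-q q%4))
  open ≡-Reasoning

  -- h = (q + 1) / 2 and H = (q² - 1) / 2, so that x ^ H is the quadratic character of x.
  m h H k : ℕ
  m = q ℕ./ 4
  h = suc (m ℕ.* 2)
  H = h ℕ.* (m ℕ.* 4)
  k = h ℕ.* h

  q≡1+m*4 : q ≡ suc (m ℕ.* 4)
  q≡1+m*4 = trans (m≡m%n+[m/n]*n q 4) (cong (ℕ._+ m ℕ.* 4) q%4)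

  [q+1]/2≡h : (q ℕ.+ 1) ℕ./ 2 ≡ h
  [q+1]/2≡h = trans (cong (λ q → (q ℕ.+ 1) ℕ./ 2) q≡1+m*4) (trans (cong (ℕ._/ 2)
    (ℕ-Solver.solve 1 (λ m → con′ 1 :+′ m :*′ con′ 4 :+′ con′ 1 :=′ (con′ 1 :+′ m :*′ con′ 2) :*′ con′ 2) refl m)) (m*n/n≡m h 2))

  [q+1]²/4≡k : (q ℕ.+ 1) ℕ.^ 2 ℕ./ 4 ≡ k
  [q+1]²/4≡k = trans (cong (λ q → (q ℕ.+ 1) ℕ.^ 2 ℕ./ 4) q≡1+m*4) (trans (cong (ℕ._/ 4)
    (ℕ-Solver.solve 1 (λ m → (con′ 1 :+′ m :*′ con′ 4 :+′ con′ 1) :^′ 2 :=′ ((con′ 1 :+′ m :*′ con′ 2) :*′ (con′ 1 :+′ m :*′ con′ 2)) :*′ con′ 4) refl m)) (m*n/n≡m k 4))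

  -- `fermat` gives x ^ (2 H) = x ^ (q² - 1) = 1.
  ^H≡±1 : ∀ {x} → x ≢ 0# → x ^ H ≡ 1# ⊎ x ^ H ≡ - 1#
  ^H≡±1 {x} x≢0 = squares-equal (trans (*-cancelˡ x≢0 x*x^H²≡x) (sym (*-identityʳ 1#)))
    where
    x*x^H²≡x : x * (x ^ H * x ^ H) ≡ x * 1#
    x*x^H²≡x = begin
      x * (x ^ H * x ^ H)     ≡⟨ cong (x *_) (^-+ x H H) ⟨
      x ^ suc (H ℕ.+ H)       ≡⟨ cong (x ^_) (trans (ℕ-Solver.solve 1 (λ m →
                                   let h = con′ 1 :+′ m :*′ con′ 2 ; H = h :*′ (m :*′ con′ 4)
                                   in con′ 1 :+′ (H :+′ H) :=′ (con′ 1 :+′ m :*′ con′ 4) :^′ 2) refl m)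
                                   (cong (ℕ._^ 2) (sym q≡1+m*4))) ⟩
      x ^ (q ℕ.^ 2)           ≡⟨ fermat x ⟩
      x                       ≡⟨ *-identityʳ x ⟨
      x * 1#                  ∎

  -- h = 2 m + 1 is odd because q ≡ 1 modulo 4.
  -1^h : (- 1#) ^ h ≡ - 1#
  -1^h = begin
    - 1# * (- 1#) ^ (m ℕ.* 2)    ≡⟨ cong (λ e → - 1# * (- 1#) ^ e) (ℕP.*-comm m 2) ⟩
    - 1# * (- 1#) ^ (2 ℕ.* m)    ≡⟨ cong (- 1# *_) (^-* (- 1#) 2 m) ⟩
    - 1# * ((- 1#) ^ 2) ^ m      ≡⟨ cong (λ u → - 1# * u ^ m) (trans (solve 1 (λ o → (:- o) :^ 2 := o :* o) refl 1#) (*-identityʳ 1#)) ⟩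
    - 1# * 1# ^ m                ≡⟨ cong (- 1# *_) (1^ m) ⟩
    - 1# * 1#                    ≡⟨ *-identityʳ _ ⟩
    - 1#                         ∎

  -- k (q - 1) = H h, so the Frobenius multiplies x ^ k by the h-th power of the quadratic character
  -- of x.
  σ-power : ∀ x → σ (x ^ k) ≡ x ^ k * (x ^ H) ^ h
  σ-power x = begin
    σ (x ^ k)                  ≡⟨ ^-* x k q ⟨
    x ^ (k ℕ.* q)              ≡⟨ cong (x ^_) (trans (cong (k ℕ.*_) q≡1+m*4) (ℕ-Solver.solve 2 (λ h m →
                                    h :*′ h :*′ (con′ 1 :+′ m :*′ con′ 4) :=′ h :*′ h :+′ h :*′ (m :*′ con′ 4) :*′ h) refl h m)) ⟩
    x ^ (k ℕ.+ H ℕ.* h)        ≡⟨ ^-+ x k (H ℕ.* h) ⟩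
    x ^ k * x ^ (H ℕ.* h)      ≡⟨ cong (x ^ k *_) (^-* x H h) ⟩
    x ^ k * (x ^ H) ^ h        ∎

  module _ {γ : Carrier} (γ-cond : (num 2 * γ) ^ h ≡ 1#) where
    δ = num 2 * γ

    f : Carrier → Carrier
    f x = x + γ * tr 2 (x ^ k)

    -- Here σ y = - y, so the trace vanishes.
    f-nonsquare : ∀ {x} → x ^ H ≡ - 1# → f x ≡ x
    f-nonsquare {x} x^H = begin
      x + γ * tr 2 y       ≡⟨ cong (λ t → x + γ * t) (tr₂ y) ⟩
      x + γ * (σ y + y)    ≡⟨ cong (λ z → x + γ * (z + y)) (trans (σ-power x) (cong (y *_) (trans (cong (_^ h) x^H) -1^h))) ⟩
      x + γ * (y * - 1# + y) ≡⟨ cong (λ z → x + γ * (y * - 1# + z)) (*-identityʳ y) ⟨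
      x + γ * (y * - 1# + y * 1#) ≡⟨ solve 4 (λ x g y o → x :+ g :* (y :* (:- o) :+ y :* o) := x) refl x γ y 1# ⟩
      x                    ∎
      where y = x ^ k

    f-zero : ∀ {x} → x ≡ 0# → f x ≡ 0#
    f-zero refl = begin
      0# + γ * tr 2 (0# ^ k)   ≡⟨ cong (λ y → 0# + γ * tr 2 y) (zeroˡ _) ⟩
      0# + γ * tr 2 0#         ≡⟨ cong (λ t → 0# + γ * t) (trans (tr₂ 0#) (trans (cong (_+ 0#) σ-0) (+-identityʳ 0#))) ⟩
      0# + γ * 0#              ≡⟨ solve 1 (λ g → κ 0 :+ g :* κ 0 := κ 0) refl γ ⟩
      0#                       ∎

    δσδ : δ * σ δ ≡ 1#
    δσδ = begin
      δ ^ suc q        ≡⟨ cong (δ ^_) (trans (cong suc q≡1+m*4) (ℕ-Solver.solve 1 (λ m →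
                            con′ 2 :+′ m :*′ con′ 4 :=′ (con′ 1 :+′ m :*′ con′ 2) :+′ (con′ 1 :+′ m :*′ con′ 2)) refl m)) ⟩
      δ ^ (h ℕ.+ h)    ≡⟨ ^-+ δ h h ⟩
      δ ^ h * δ ^ h    ≡⟨ cong₂ _*_ γ-cond γ-cond ⟩
      1# * 1#          ≡⟨ *-identityʳ 1# ⟩
      1#               ∎

    module Square {x} (x≢0 : x ≢ 0#) (x^H : x ^ H ≡ 1#) where
      y = x ^ k

      σy : σ y ≡ y
      σy = trans (σ-power x) (trans (cong (y *_) (trans (cong (_^ h) x^H) (1^ h))) (*-identityʳ y))

      f-square : f x ≡ x + δ * y
      f-square = begin
        x + γ * tr 2 y     ≡⟨ cong (λ t → x + γ * t) (trans (tr₂ y) (cong (_+ y) σy)) ⟩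
        x + γ * (y + y)    ≡⟨ solve 3 (λ x g y → x :+ g :* (y :+ y) := x :+ κ 2 :* g :* y) refl x γ y ⟩
        x + δ * y          ∎

      -- 2 k = q + 1 + H.
      y² : y * y ≡ x * σ x
      y² = begin
        y * y                  ≡⟨ ^-+ x k k ⟨
        x ^ (k ℕ.+ k)          ≡⟨ cong (x ^_) (trans (ℕ-Solver.solve 1 (λ m →
                                    let h = con′ 1 :+′ m :*′ con′ 2 ; H = h :*′ (m :*′ con′ 4)
                                    in h :*′ h :+′ h :*′ h :=′ con′ 1 :+′ (con′ 1 :+′ m :*′ con′ 4) :+′ H) refl m)
                                    (cong (λ q → suc q ℕ.+ H) (sym q≡1+m*4))) ⟩
        x ^ (suc q ℕ.+ H)      ≡⟨ ^-+ x (suc q) H ⟩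
        x * σ x * x ^ H        ≡⟨ cong (x * σ x *_) x^H ⟩
        x * σ x * 1#           ≡⟨ *-identityʳ _ ⟩
        x * σ x                ∎

      c = f x

      -- y c = x y + δ y² = x (y + δ σ x), and δ σ δ = 1 turns the bracket into δ σ c. Thus c
      -- determines y / x, and then x through c / x = 1 + δ y / x.
      ratio : y * c ≡ x * (δ * σ c)
      ratio = begin
        y * c                          ≡⟨ cong (y *_) f-square ⟩
        y * (x + δ * y)                ≡⟨ by₂ y² (trans δσδ (sym (+-identityʳ 1#))) (solve 5 (λ x x₁ y d d₁ → y :* (x :+ d :* y)
                                            := x :* (d :* (x₁ :+ d₁ :* y)) :+ d :* (y :* y :- x :* x₁) :+ (:- (x :* y)) :* (d :* d₁ :- κ 1)) refl x (σ x) y δ (σ δ)) ⟩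
        x * (δ * (σ x + σ δ * y))      ≡⟨ cong (λ u → x * (δ * (σ x + σ δ * u))) σy ⟨
        x * (δ * (σ x + σ δ * σ y))    ≡⟨ cong (λ u → x * (δ * u)) (trans (σ-+ _ _) (cong (σ x +_) (σ-* δ y))) ⟨
        x * (δ * σ (x + δ * y))        ≡⟨ cong (λ u → x * (δ * σ u)) f-square ⟨
        x * (δ * σ c)                  ∎

      -- If c = 0 then x = - δ y. In its k-th power -1 is kept since h is odd, δ contributes 1, and
      -- y ^ k = y because y lies in F_q and k ≡ 1 modulo q - 1. So y = x ^ k = - y.
      c≢0 : c ≢ 0#
      c≢0 c≡0 = x≢0 (trans x≡ (trans (cong (λ u → - 1# * (δ * u)) (≡-neg⇒≡0 y≡-y))
          (solve 2 (λ o d → (:- o) :* (d :* κ 0) := κ 0) refl 1# δ)))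
        where
        x≡ : x ≡ - 1# * (δ * y)
        x≡ = trans (by₁ (trans (sym f-square) c≡0) (solve 3 (λ x d y → x := :- (d :* y) :+ κ 1 :* (x :+ d :* y :- κ 0)) refl x δ y))
          (sym (trans (solve 2 (λ o u → (:- o) :* u := :- (o :* u)) refl 1# (δ * y)) (cong -_ (*-identityˡ _))))

        ^k-one : ∀ {u} → u ^ h ≡ u → u ^ k ≡ u
        ^k-one {u} e = trans (^-* u h h) (trans (cong (_^ h) e) e)

        y^k : y ^ k ≡ y
        y^k = trans (cong (y ^_) (ℕ-Solver.solve 1 (λ m →
                (con′ 1 :+′ m :*′ con′ 2) :*′ (con′ 1 :+′ m :*′ con′ 2) :=′ con′ 1 :+′ (con′ 1 :+′ m) :*′ (m :*′ con′ 4)) refl m))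
          (fixed-^ σy q≡1+m*4 (1 ℕ.+ m))

        y≡-y : y ≡ - y
        y≡-y = begin
          x ^ k                              ≡⟨ cong (_^ k) x≡ ⟩
          (- 1# * (δ * y)) ^ k               ≡⟨ trans (*-^ (- 1#) (δ * y) k) (cong ((- 1#) ^ k *_) (*-^ δ y k)) ⟩
          (- 1#) ^ k * (δ ^ k * y ^ k)       ≡⟨ cong₂ _*_ (^k-one -1^h) (cong₂ _*_ (trans (^-* δ h h) (trans (cong (_^ h) γ-cond) (1^ h))) y^k) ⟩
          - 1# * (1# * y)                    ≡⟨ cong (- 1# *_) (*-identityˡ y) ⟩
          - 1# * y                           ≡⟨ solve 2 (λ o u → (:- o) :* u := :- (o :* u)) refl 1# y ⟩
          - (1# * y)                         ≡⟨ cong -_ (*-identityˡ y) ⟩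
          - y                                ∎

      -- In the h-th power of `ratio` the factors y ^ h = x ^ h and δ ^ h = 1 drop out, leaving c ^
      -- h = (σ c) ^ h = c ^ h c ^ H.
      c^H : c ^ H ≡ 1#
      c^H = *-cancelˡ (λ e → c≢0 (^≡0⇒≡0 h e)) (*-cancelˡ (λ e → x≢0 (^≡0⇒≡0 h e)) (sym (begin
        x ^ h * (c ^ h * 1#)                 ≡⟨ cong (x ^ h *_) (*-identityʳ _) ⟩
        x ^ h * c ^ h                        ≡⟨ cong (_* c ^ h) y^h ⟨
        y ^ h * c ^ h                        ≡⟨ *-^ y c h ⟨
        (y * c) ^ h                          ≡⟨ cong (_^ h) ratio ⟩
        (x * (δ * σ c)) ^ h                  ≡⟨ trans (*-^ x _ h) (cong (x ^ h *_) (*-^ δ (σ c) h)) ⟩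
        x ^ h * (δ ^ h * σ c ^ h)            ≡⟨ cong (λ u → x ^ h * (u * σ c ^ h)) γ-cond ⟩
        x ^ h * (1# * σ c ^ h)               ≡⟨ cong (x ^ h *_) (*-identityˡ _) ⟩
        x ^ h * σ c ^ h                      ≡⟨ cong (x ^ h *_) σc^h ⟩
        x ^ h * (c ^ h * c ^ H)              ∎)))
        where
        y^h : y ^ h ≡ x ^ h
        y^h = begin
          y ^ h                                  ≡⟨ ^-* x k h ⟨
          x ^ (k ℕ.* h)                          ≡⟨ cong (x ^_) (ℕ-Solver.solve 1 (λ m →
                                                      let h = con′ 1 :+′ m :*′ con′ 2 ; H = h :*′ (m :*′ con′ 4)
                                                      in h :*′ h :*′ h :=′ h :+′ H :*′ (con′ 1 :+′ m)) refl m) ⟩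
          x ^ (h ℕ.+ H ℕ.* (1 ℕ.+ m))            ≡⟨ trans (^-+ x h _) (cong (x ^ h *_) (^-* x H (1 ℕ.+ m))) ⟩
          x ^ h * (x ^ H) ^ (1 ℕ.+ m)            ≡⟨ cong (x ^ h *_) (trans (cong (_^ (1 ℕ.+ m)) x^H) (1^ (1 ℕ.+ m))) ⟩
          x ^ h * 1#                             ≡⟨ *-identityʳ _ ⟩
          x ^ h                                  ∎

        σc^h : σ c ^ h ≡ c ^ h * c ^ H
        σc^h = begin
          σ c ^ h               ≡⟨ ^-* c q h ⟨
          c ^ (q ℕ.* h)         ≡⟨ cong (c ^_) (trans (cong (ℕ._* h) q≡1+m*4) (ℕ-Solver.solve 2 (λ h m →
                                     (con′ 1 :+′ m :*′ con′ 4) :*′ h :=′ h :+′ h :*′ (m :*′ con′ 4)) refl h m)) ⟩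
          c ^ (h ℕ.+ H)         ≡⟨ ^-+ c h H ⟩
          c ^ h * c ^ H         ∎

    f≡0⇒≡0 : ∀ {x} → f x ≡ 0# → x ≡ 0#
    f≡0⇒≡0 {x} fx≡0 = decidable-stable (x ≟ 0#) (λ x≢0 →
      [ (λ x^H → Square.c≢0 x≢0 x^H fx≡0) , (λ x^H → x≢0 (trans (sym (f-nonsquare x^H)) fx≡0)) ]′ (^H≡±1 x≢0))

    -- Two arguments with the same value therefore have the same quadratic character, so squares and
    -- nonsquares can be treated apart.
    f-^H : ∀ {x} → x ≢ 0# → f x ^ H ≡ x ^ H
    f-^H {x} x≢0 = [ (λ x^H → trans (Square.c^H x≢0 x^H) (sym x^H)) , (λ x^H → cong (_^ H) (f-nonsquare x^H)) ]′ (^H≡±1 x≢0)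

    unique-square : ∀ {x x′} → x ≢ 0# → x′ ≢ 0# → x ^ H ≡ 1# → x′ ^ H ≡ 1# → f x ≡ f x′ → x ≡ x′
    unique-square {x} {x′} x≢0 x′≢0 x^H x′^H eq = sym (*-cancelˡ S.c≢0 cx′≡cx)
      where
      module S = Square x≢0 x^H
      module S′ = Square x′≢0 x′^H

      ratio′ : S′.y * f x ≡ x′ * (δ * σ (f x))
      ratio′ = subst (λ c → S′.y * c ≡ x′ * (δ * σ c)) (sym eq) S′.ratio

      yx′≡y′x : S.y * x′ ≡ S′.y * x
      yx′≡y′x = *-cancelˡ S.c≢0 (by₂ S.ratio ratio′ (solve 6 (λ c e x x′ y y′ → c :* (y :* x′) := c :* (y′ :* x)
        :+ x′ :* (y :* c :- x :* e) :+ (:- x) :* (y′ :* c :- x′ :* e)) refl (f x) (δ * σ (f x)) x x′ S.y S′.y))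

      cx′≡cx : f x * x′ ≡ f x * x
      cx′≡cx = begin
        f x * x′                  ≡⟨ cong (_* x′) S.f-square ⟩
        (x + δ * S.y) * x′        ≡⟨ by₁ yx′≡y′x (solve 5 (λ x x′ d y y′ → (x :+ d :* y) :* x′ := (x′ :+ d :* y′) :* x :+ d :* (y :* x′ :- y′ :* x)) refl x x′ δ S.y S′.y) ⟩
        (x′ + δ * S′.y) * x       ≡⟨ cong (_* x) (trans eq S′.f-square) ⟨
        f x * x                   ∎

    f-injective : Injective _≡_ _≡_ f
    f-injective {x} {x′} eq = case (x ≟ 0#)
      where
      case : Dec (x ≡ 0#) → x ≡ x′
      case (yes x≡0) = trans x≡0 (sym (f≡0⇒≡0 (trans (sym eq) (f-zero x≡0))))
      case (no x≢0) = [ (λ x^H → unique-square x≢0 x′≢0 x^H (trans (sym x^H≡x′^H) x^H) eq)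
                      , (λ x^H → trans (sym (f-nonsquare x^H)) (trans eq (f-nonsquare (trans (sym x^H≡x′^H) x^H)))) ]′ (^H≡±1 x≢0)
        where
        x′≢0 : x′ ≢ 0#
        x′≢0 x′≡0 = x≢0 (f≡0⇒≡0 (trans eq (f-zero x′≡0)))

        x^H≡x′^H : x ^ H ≡ x′ ^ H
        x^H≡x′^H = trans (sym (f-^H x≢0)) (trans (cong (_^ H) eq) (f-^H x′≢0))

  case-d-injective : ∀ {γ} → (num 2 * γ) ^ ((q ℕ.+ 1) ℕ./ 2) ≡ 1#
    → Injective _≡_ _≡_ (λ x → x + γ * tr 2 (x ^ ((q ℕ.+ 1) ℕ.^ 2 ℕ./ 4)))
  case-d-injective {γ} γ-cond = subst (λ k → Injective _≡_ _≡_ (λ x → x + γ * tr 2 (x ^ k))) (sym [q+1]²/4≡k)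
    (f-injective (subst (λ e → (num 2 * γ) ^ e ≡ 1#) [q+1]/2≡h γ-cond))

-- Cases (e) and (f): the Frobenius of order four

module CasesEF {Q : ℕ} (F : FiniteField ((Q ℕ.^ 2) ℕ.^ 2)) (pp : IsPrimePower (Q ℕ.^ 2)) (ppQ : IsPrimePower Q) (Q%2 : Q ℕ.% 2 ≡ 1) where
  open Trace {Q ℕ.^ 2} {2} F pp
  open Quadratic F pp using (q∸1; q≡)
  open ≡-Reasoning

  ς : Carrier → Carrier
  ς = _^ Q

  ς-endo : IsEndo ς
  ς-endo = frobenius 4 ppQ (ℕP.^-*-assoc Q 2 2)

  ςς≡σ : ∀ x → ς (ς x) ≡ σ x
  ςς≡σ x = trans (sym (^-* x Q Q)) (cong (λ j → x ^ (Q ℕ.* j)) (sym (ℕP.*-identityʳ Q)))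

  ς⁴ : ∀ x → ς (ς (ς (ς x))) ≡ x
  ς⁴ x = trans (ςς≡σ (ς (ς x))) (trans (cong σ (ςς≡σ x)) (trans (σσ-iterate x) (fermat x)))

  ς³≡ : ∀ x → ς (ς (ς x)) ≡ x ^ (Q ℕ.^ 3)
  ς³≡ x = trans (ςς≡σ (ς x)) (sym (^-* x Q (Q ℕ.^ 2)))

  2≢0 : num 2 ≢ 0#
  2≢0 = %≡1⇒num≢0 Q 2 (^≡0⇒≡0 2 (trans (sym (num-^ Q 2)) num-q)) Q%2

  module _ {γ : Carrier} (γ≡-1 : γ ≡ - 1#) where
    hγ : γ ≡ - num 1
    hγ = trans γ≡-1 (cong -_ (sym (+-identityʳ 1#)))

    -- 1 + 2 γ = - 1.
    coefficient : num 1 + γ * num 2 ≢ 0#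
    coefficient h = num-1 (by₂ h hγ (solve 1 (λ g → κ 1 := κ 0 :+ con (negsuc 0) :* (κ 1 :+ g :* κ 2 :- κ 0) :+ κ 2 :* (g :- (:- κ 1))) refl γ))

    value : ∀ {x x′ T T′} → x + γ * T ≡ x′ + γ * T′ → x - T ≡ x′ - T′
    value {x} {x′} {T} {T′} eq = by₂ eq hγ (solve 5 (λ x x′ g t t′ → x :- t := x′ :- t′
      :+ κ 1 :* (x :+ g :* t :- (x′ :+ g :* t′)) :+ (t′ :- t) :* (g :- (:- κ 1))) refl x x′ γ T T′)

    Q³≡ : Q ℕ.^ 3 ≡ Q ℕ.+ Q ℕ.* q∸1
    Q³≡ = trans (cong (Q ℕ.*_) q≡) (ℕP.*-suc Q q∸1)

    case-e-injective : Injective _≡_ _≡_ (λ x → x + γ * tr 2 (x ^ (Q ℕ.^ 3 ℕ.∸ Q ℕ.+ 1)))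
    case-e-injective = injective-from-generic Q q≡ k≡ coefficient generic
      where
      open QuarticTrace F using (quartic-trace)
      k = Q ℕ.^ 3 ℕ.∸ Q ℕ.+ 1

      k≡ : k ≡ suc (Q ℕ.* q∸1)
      k≡ = trans (ℕP.+-comm _ 1) (cong suc (trans (cong (ℕ._∸ Q) Q³≡) (ℕP.m+n∸m≡n Q (Q ℕ.* q∸1))))

      power : ∀ x → x ^ k * ς x ≡ ς (ς (ς x)) * x
      power x = begin
        x ^ k * ς x            ≡⟨ ^-+ x k Q ⟨
        x ^ (k ℕ.+ Q)          ≡⟨ cong (x ^_) (trans (cong (ℕ._+ Q) k≡) (cong suc (trans (ℕP.+-comm _ Q) (sym Q³≡)))) ⟩
        x * x ^ (Q ℕ.^ 3)      ≡⟨ cong (x *_) (ς³≡ x) ⟨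
        x * ς (ς (ς x))        ≡⟨ *-comm _ _ ⟩
        ς (ς (ς x)) * x        ∎

      trace : ∀ x → tr 2 (x ^ k) * (ς x * ς (ς (ς x))) ≡ x * ς (ς (ς x)) ^ 2 + ς (ς x) * ς x ^ 2
      trace x = trans (cong (_* (ς x * ς (ς (ς x)))) (trans (tr₂ _) (cong (_+ x ^ k) (sym (ςς≡σ _)))))
        (by₂ (power x) ςς-power (solve 6 (λ a a₁ a₂ a₃ y z → (z :+ y) :* (a₁ :* a₃) := a :* a₃ :^ 2 :+ a₂ :* a₁ :^ 2
          :+ a₃ :* (y :* a₁ :- a₃ :* a) :+ a₁ :* (z :* a₃ :- a₁ :* a₂)) refl x (ς x) (ς (ς x)) (ς (ς (ς x))) (x ^ k) (ς (ς (x ^ k)))))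
        where
        ςς-power : ς (ς (x ^ k)) * ς (ς (ς x)) ≡ ς x * ς (ς x)
        ςς-power = trans (sym (IsEndo.σ-* (∘-endo ς-endo ς-endo) _ _)) (trans (cong (ς ∘ ς) (power x))
          (trans (IsEndo.σ-* (∘-endo ς-endo ς-endo) _ _) (cong (_* ς (ς x)) (ς⁴ (ς x)))))

      generic : ∀ {x x′} → x + γ * tr 2 (x ^ k) ≡ x′ + γ * tr 2 (x′ ^ k) → x ≡ x′ ⊎ (σ x ≡ x × σ x′ ≡ x′)
      generic {x} {x′} eq = Sum⊎.map₂ (λ (h , h′) → trans (sym (ςς≡σ x)) h , trans (sym (ςς≡σ x′)) h′)
        (quartic-trace 2≢0 ς-endo ς⁴ (trans (ςς≡σ _) (tr-fixed _)) (trans (ςς≡σ _) (tr-fixed _)) (trace x) (trace x′) (value eq))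

    -- This is the previous case with the inverse Frobenius x ↦ x ^ Q³ in place of x ↦ x ^ Q.
    case-f-injective : Injective _≡_ _≡_ (λ x → x + γ * tr 2 (x ^ (Q ℕ.^ 3 ℕ.+ Q ℕ.^ 2 ℕ.∸ Q)))
    case-f-injective = injective-from-generic (suc Q) q≡ k≡ coefficient generic
      where
      open QuarticTrace F using (quartic-trace)
      k = Q ℕ.^ 3 ℕ.+ Q ℕ.^ 2 ℕ.∸ Q

      τ : Carrier → Carrier
      τ = ς ∘ ς ∘ ς

      τ-endo : IsEndo τ
      τ-endo = ∘-endo ς-endo (∘-endo ς-endo ς-endo)

      ττ : ∀ x → τ (τ x) ≡ ς (ς x)
      ττ x = ς⁴ (ς (ς x))

      τττ : ∀ x → τ (τ (τ x)) ≡ ς x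
      τττ x = trans (cong τ (ττ x)) (ς⁴ (ς x))

      τ⁴ : ∀ x → τ (τ (τ (τ x))) ≡ x
      τ⁴ x = trans (ττ (τ (τ x))) (trans (cong (ς ∘ ς) (ττ x)) (ς⁴ x))

      Q³+Q²≡ : Q ℕ.^ 3 ℕ.+ Q ℕ.^ 2 ≡ Q ℕ.+ suc (suc Q ℕ.* q∸1)
      Q³+Q²≡ = trans (cong₂ ℕ._+_ Q³≡ q≡) (ℕ-Solver.solve 2 (λ Q r → Q :+′ Q :*′ r :+′ (con′ 1 :+′ r) :=′ Q :+′ (con′ 1 :+′ (con′ 1 :+′ Q) :*′ r)) refl Q q∸1)

      k≡ : k ≡ suc (suc Q ℕ.* q∸1)
      k≡ = trans (cong (ℕ._∸ Q) Q³+Q²≡) (ℕP.m+n∸m≡n Q _)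

      power : ∀ x → x ^ k * ς x ≡ ς (ς (ς x)) * ς (ς x)
      power x = begin
        x ^ k * ς x                        ≡⟨ ^-+ x k Q ⟨
        x ^ (k ℕ.+ Q)                      ≡⟨ cong (x ^_) (trans (cong (ℕ._+ Q) k≡) (trans (ℕP.+-comm _ Q) (sym Q³+Q²≡))) ⟩
        x ^ (Q ℕ.^ 3 ℕ.+ Q ℕ.^ 2)          ≡⟨ ^-+ x (Q ℕ.^ 3) (Q ℕ.^ 2) ⟩
        x ^ (Q ℕ.^ 3) * x ^ (Q ℕ.^ 2)      ≡⟨ cong₂ _*_ (ς³≡ x) (ςς≡σ x) ⟨
        ς (ς (ς x)) * ς (ς x)              ∎

      -- For τ the two summands of the trace exchange roles: it is σ (x ^ k), not x ^ k, that has
      -- the form x τ³ x / τ x of the previous case.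
      trace : ∀ x → tr 2 (x ^ k) * (τ x * τ (τ (τ x))) ≡ x * τ (τ (τ x)) ^ 2 + τ (τ x) * τ x ^ 2
      trace x = subst₂ (λ a₁ a₂ → tr 2 (x ^ k) * (τ x * a₁) ≡ x * a₁ ^ 2 + a₂ * τ x ^ 2) (sym (τττ x)) (sym (ττ x))
        (trans (cong (_* (τ x * ς x)) (trans (tr₂ _) (cong (_+ x ^ k) (sym (ςς≡σ _)))))
          (by₂ (power x) ςς-power (solve 6 (λ a a₁ a₂ a₃ y z → (z :+ y) :* (a₃ :* a₁) := a :* a₁ :^ 2 :+ a₂ :* a₃ :^ 2
            :+ a₃ :* (y :* a₁ :- a₃ :* a₂) :+ a₁ :* (z :* a₃ :- a₁ :* a)) refl x (ς x) (ς (ς x)) (τ x) (x ^ k) (ς (ς (x ^ k))))))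
        where
        ςς-power : ς (ς (x ^ k)) * τ x ≡ ς x * x
        ςς-power = trans (sym (IsEndo.σ-* (∘-endo ς-endo ς-endo) _ _)) (trans (cong (ς ∘ ς) (power x))
          (trans (IsEndo.σ-* (∘-endo ς-endo ς-endo) _ _) (cong₂ _*_ (ς⁴ (ς x)) (ς⁴ x))))

      ττ≡σ : ∀ x → τ (τ x) ≡ σ x
      ττ≡σ x = trans (ττ x) (ςς≡σ x)

      generic : ∀ {x x′} → x + γ * tr 2 (x ^ k) ≡ x′ + γ * tr 2 (x′ ^ k) → x ≡ x′ ⊎ (σ x ≡ x × σ x′ ≡ x′)
      generic {x} {x′} eq = Sum⊎.map₂ (λ (h , h′) → trans (sym (ττ≡σ x)) h , trans (sym (ττ≡σ x′)) h′)
        (quartic-trace 2≢0 τ-endo τ⁴ (trans (ττ≡σ _) (tr-fixed _)) (trans (ττ≡σ _) (tr-fixed _)) (trace x) (trace x′) (value eq))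

-- Degree three: cases (g) and (h)

module Cubic {q : ℕ} (F : FiniteField (q ℕ.^ 3)) (pp : IsPrimePower q) (q%2 : q ℕ.% 2 ≡ 1) where
  open Trace {q} {3} F pp
  open RootTraces F using (square-root-trace; inverse-trace)
  open ≡-Reasoning

  2≢0 : num 2 ≢ 0#
  2≢0 = %≡1⇒num≢0 q 2 num-q q%2

  σ³ : ∀ x → σ (σ (σ x)) ≡ x
  σ³ x = trans (cong σ (σσ-iterate x)) (trans (σ-iterate x 2) (fermat x))

  m : ℕ
  m = q ℕ./ 2

  q≡ : q ≡ suc (m ℕ.* 2)
  q≡ = trans (m≡m%n+[m/n]*n q 2) (cong (ℕ._+ m ℕ.* 2) q%2)

  -- 2 k = q² + 1 makes y = x ^ k a square root of x σ² x. Because k ≡ 1 modulo q - 1, the norm of y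
  -- is that of x, which supplies the sign condition of `square-root-trace`.
  case-g-injective : ∀ {γ} → γ ≡ 1# → Injective _≡_ _≡_ (λ x → x + γ * tr 3 (x ^ ((q ℕ.^ 2 ℕ.+ 1) ℕ./ 2)))
  case-g-injective {γ} γ≡1 = injective-from-generic (1 ℕ.+ m) q≡ k≡ coefficient generic
    where
    k = (q ℕ.^ 2 ℕ.+ 1) ℕ./ 2

    2k′≡ : q ℕ.^ 2 ℕ.+ 1 ≡ suc ((1 ℕ.+ m) ℕ.* (m ℕ.* 2)) ℕ.* 2
    2k′≡ = trans (cong (λ q → q ℕ.^ 2 ℕ.+ 1) q≡) (ℕ-Solver.solve 1 (λ m →
      (con′ 1 :+′ m :*′ con′ 2) :^′ 2 :+′ con′ 1 :=′ (con′ 1 :+′ (con′ 1 :+′ m) :*′ (m :*′ con′ 2)) :*′ con′ 2) refl m)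

    k≡ : k ≡ suc ((1 ℕ.+ m) ℕ.* (m ℕ.* 2))
    k≡ = trans (cong (ℕ._/ 2) 2k′≡) (m*n/n≡m (suc ((1 ℕ.+ m) ℕ.* (m ℕ.* 2))) 2)

    -- For γ = 1 this is 4, the square of 2.
    coefficient : num 1 + γ * num 3 ≢ 0#
    coefficient h = *-nonzero 2≢0 2≢0 (by₂ h (trans γ≡1 (sym (+-identityʳ 1#)))
      (solve 1 (λ g → κ 2 :* κ 2 := κ 0 :+ κ 1 :* (κ 1 :+ g :* κ 3 :- κ 0) :+ (:- κ 3) :* (g :- κ 1)) refl γ))

    y² : ∀ x → x ^ k * x ^ k ≡ x * σ (σ x)
    y² x = begin
      x ^ k * x ^ k            ≡⟨ ^-+ x k k ⟨
      x ^ (k ℕ.+ k)            ≡⟨ cong (x ^_) (trans (cong₂ ℕ._+_ k≡ k≡) (trans (ℕ-Solver.solve 1 (λ a → a :+′ a :=′ a :*′ con′ 2) refl (suc ((1 ℕ.+ m) ℕ.* (m ℕ.* 2)))) (trans (sym 2k′≡) (ℕP.+-comm _ 1)))) ⟩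
      x * x ^ (q ℕ.^ 2)        ≡⟨ cong (x *_) (σσ-iterate x) ⟨
      x * σ (σ x)              ∎

    norm-power : ∀ x → x ^ k * (σ (x ^ k) * σ (σ (x ^ k))) ≡ x * (σ x * σ (σ x))
    norm-power x = begin
      x ^ k * (σ (x ^ k) * σ (σ (x ^ k)))      ≡⟨ cong (x ^ k *_) (cong₂ _*_ (σ-^ x k) (trans (cong σ (σ-^ x k)) (σ-^ (σ x) k))) ⟩
      x ^ k * (σ x ^ k * σ (σ x) ^ k)          ≡⟨ trans (*-^ x _ k) (cong (x ^ k *_) (*-^ (σ x) _ k)) ⟨
      N ^ k                                    ≡⟨ cong (N ^_) k≡ ⟩
      N ^ suc ((1 ℕ.+ m) ℕ.* (m ℕ.* 2))        ≡⟨ fixed-^ σN q≡ (1 ℕ.+ m) ⟩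
      N                                        ∎
      where
      N = x * (σ x * σ (σ x))

      σN : σ N ≡ N
      σN = trans (σ-⟦⟧ σ-endo (var 0F :* (var 1F :* var 2F)) {x ∷ σ x ∷ σ (σ x) ∷ []} (cong (λ a → σ x ∷ σ (σ x) ∷ a ∷ []) (σ³ x)))
        (solve 3 (λ a b c → b :* (c :* a) := a :* (b :* c)) refl x (σ x) (σ (σ x)))

    value : ∀ x → x + γ * tr 3 (x ^ k) ≡ x + (σ (σ (x ^ k)) + (σ (x ^ k) + x ^ k))
    value x = cong (x +_) (trans (cong₂ _*_ γ≡1 (tr₃ _)) (*-identityˡ _))

    generic : ∀ {x x′} → x + γ * tr 3 (x ^ k) ≡ x′ + γ * tr 3 (x′ ^ k) → x ≡ x′ ⊎ (σ x ≡ x × σ x′ ≡ x′)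
    generic {x} {x′} eq = square-root-trace σ-endo 2≢0 σ³ (y² x) (y² x′) (norm-power x) (norm-power x′)
      (trans (sym (value x)) (trans eq (value x′)))

  -- Here x ^ k = x σ² x / σ x. Multiplying the trace by the norm of x clears all three denominators
  -- and gives the relation of `inverse-trace`.
  case-h-injective : ∀ {γ} → num 2 * γ ≡ - 1# → Injective _≡_ _≡_ (λ x → x + γ * tr 3 (x ^ (q ℕ.^ 2 ℕ.∸ q ℕ.+ 1)))
  case-h-injective {γ} 2γ = injective-from-generic q q≡ k≡ coefficient generic
    where
    k = q ℕ.^ 2 ℕ.∸ q ℕ.+ 1
    r = m ℕ.* 2

    q²≡ : q ℕ.^ 2 ≡ q ℕ.+ q ℕ.* r
    q²≡ = trans (cong (q ℕ.*_) (trans (ℕP.*-identityʳ q) q≡)) (ℕP.*-suc q r)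

    k≡ : k ≡ suc (q ℕ.* r)
    k≡ = trans (ℕP.+-comm _ 1) (cong suc (trans (cong (ℕ._∸ q) q²≡) (ℕP.m+n∸m≡n q (q ℕ.* r))))

    hγ : num 2 * γ ≡ - num 1
    hγ = trans 2γ (cong -_ (sym (+-identityʳ 1#)))

    -- By 2 γ = - 1, twice this coefficient is - 1.
    coefficient : num 1 + γ * num 3 ≢ 0#
    coefficient h = num-1 (by₂ h hγ (solve 1 (λ g → κ 1 := κ 0 :+ (:- κ 2) :* (κ 1 :+ g :* κ 3 :- κ 0)
      :+ κ 3 :* (κ 2 :* g :- (:- κ 1))) refl γ))

    power : ∀ x → x ^ k * σ x ≡ σ (σ x) * x
    power x = begin
      x ^ k * σ x            ≡⟨ ^-+ x k q ⟨
      x ^ (k ℕ.+ q)          ≡⟨ cong (x ^_) (trans (cong (ℕ._+ q) k≡) (cong suc (trans (ℕP.+-comm _ q) (sym q²≡)))) ⟩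
      x * x ^ (q ℕ.^ 2)      ≡⟨ cong (x *_) (σσ-iterate x) ⟨
      x * σ (σ x)            ≡⟨ *-comm _ _ ⟩
      σ (σ x) * x            ∎

    σ-product : ∀ {u v u′ v′} → u * v ≡ u′ * v′ → σ u * σ v ≡ σ u′ * σ v′
    σ-product h = trans (sym (σ-* _ _)) (trans (cong σ h) (σ-* _ _))

    trace : ∀ x → tr 3 (x ^ k) * (x * (σ x * σ (σ x))) ≡ (x * σ x) ^ 2 + (σ x * σ (σ x)) ^ 2 + (σ (σ x) * x) ^ 2
    trace x = trans (cong (_* (x * (σ x * σ (σ x)))) (tr₃ (x ^ k))) (by₃ (power x) power₁ power₂
      (solve 6 (λ a b c y₀ y₁ y₂ → (y₂ :+ (y₁ :+ y₀)) :* (a :* (b :* c)) := (a :* b) :^ 2 :+ (b :* c) :^ 2 :+ (c :* a) :^ 2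
        :+ c :* a :* (y₀ :* b :- c :* a) :+ a :* b :* (y₁ :* c :- a :* b) :+ b :* c :* (y₂ :* a :- b :* c))
        refl x (σ x) (σ (σ x)) (x ^ k) (σ (x ^ k)) (σ (σ (x ^ k)))))
      where
      power₁ : σ (x ^ k) * σ (σ x) ≡ x * σ x
      power₁ = trans (σ-product (power x)) (cong (_* σ x) (σ³ x))

      power₂ : σ (σ (x ^ k)) * x ≡ σ x * σ (σ x)
      power₂ = trans (cong (σ (σ (x ^ k)) *_) (sym (σ³ x))) (σ-product power₁)

    generic : ∀ {x x′} → x + γ * tr 3 (x ^ k) ≡ x′ + γ * tr 3 (x′ ^ k) → x ≡ x′ ⊎ (σ x ≡ x × σ x′ ≡ x′)
    generic {x} {x′} eq = inverse-trace σ-endo 2≢0 σ³ (tr-fixed _) (tr-fixed _) (trace x) (trace x′)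
      (by₂ eq hγ (solve 5 (λ x x′ g t t′ → κ 2 :* x :- t := κ 2 :* x′ :- t′ :+ κ 2 :* (x :+ g :* t :- (x′ :+ g :* t′))
        :+ (t′ :- t) :* (κ 2 :* g :- (:- κ 1))) refl x x′ γ (tr 3 (x ^ k)) (tr 3 (x′ ^ k))))

-- Assembly of the nine cases

open import Data.Nat using (_≤_; _^_)

theorem1p1 : (q n k : ℕ) → IsPrimePower q → 1 ≤ n → 1 ≤ k
    → (F : FiniteField (q ^ n)) → (γ : FiniteField.Carrier F)
    → ¬ (FiniteField._≈_ F γ (FiniteField.0# F))
    → Case F q n k γ
    → IsPermutation F (λ x → FiniteField._+_ F x (FiniteField._*_ F γ (Tr F q n (pow F x k))))
theorem1p1 q n k pp _ _ F γ _ c = Field.injective⇒permutation F (injective c)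
  where
  open FiniteField F using (≈⇒≡)

  injective : Case F q n k γ → Injective _≡_ _≡_ (λ x → FiniteField._+_ F x (FiniteField._*_ F γ (Tr F q n (pow F x k))))
  injective (case-a refl q%6 3γ refl) = Quadratic.case-a-injective F pp q%6 (≈⇒≡ 3γ)
  injective (case-b refl q%6 27γ³ refl) = Quadratic.case-b-injective F pp q%6 (≈⇒≡ 27γ³)
  injective (case-c refl q%3 γ≈1 refl) = Quadratic.case-c-injective F pp q%3 (≈⇒≡ γ≈1)
  injective (case-d refl q%4 γ-cond refl) = CaseD.case-d-injective F pp q%4 (≈⇒≡ γ-cond)
  injective (case-e Q ppQ refl refl Q%2 γ≈-1 refl) = CasesEF.case-e-injective {Q} F pp ppQ Q%2 (≈⇒≡ γ≈-1)
  injective (case-f Q ppQ refl refl Q%2 γ≈-1 refl) = CasesEF.case-f-injective {Q} F pp ppQ Q%2 (≈⇒≡ γ≈-1)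
  injective (case-g refl q%2 γ≈1 refl) = Cubic.case-g-injective F pp q%2 (≈⇒≡ γ≈1)
  injective (case-h refl q%2 2γ refl) = Cubic.case-h-injective F pp q%2 (≈⇒≡ 2γ)
  injective (case-i ℓ r _ _ n≡ γ-cond refl) = Trace.case-i-injective {q} {n} F pp ℓ r n≡ (≈⇒≡ γ-cond)
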